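{- Let $\Delta\ge2$ be an integer and $\Lambda$ a real constant. Let $G=(V,E,w)$ be a weighted tree with $|V|=n\ge2$, weights $w:E\to\mathbb{R}_{>0}$, and maximum degree at most $\Delta$. Suppose that for every $S\subseteq V$ with $G[S]$ connected and $|S|\ge2$ there is an edge $e_S\in E(G[S])$ whose removal from the tree $G[S]$ produces components $A$ and $B$ (vertex sets) satisfying $$\max\{|A|-1,|B|-1\}\le\left(1-\frac1\Delta\right)(|S|-1)$$ and which also satisfies $$w_{e_S}\le\Lambda\,\frac{W(S)}{|S|-1}.$$ Then $$\frac{\operatorname{OPT}_{\mathrm{card}}(G,w)}{\operatorname{OPT}_{\mathrm{free}}(G,w)}\le\Lambda\left(1+\left\lfloor\log_{\Delta/(\Delta-1)}(n-1)\right\rfloor\right).$$ In particular, for a weighted tree $G$ of maximum degree at most $\Delta$, this bound holds if $$\frac{\max_{e\in E}w_e}{\min_{e\in E}w_e}\le\Lambda.$$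
   Context: $W(S)=\sum_{xy\in E(G[S])}w_{xy}$. $d_G$ is the shortest-path metric of $(V,E)$ with every edge of length $1$ (weights are not lengths). $\operatorname{OPT}_{\mathrm{free}}(G,w)$ is the minimum of $\sum_{xy\in E}w_{xy}u(x,y)$ over all ultrametrics $u$ on $V$ (metrics with $u(x,y)\le\max\{u(x,z),u(z,y)\}$) with $u\ge d_G$ on all pairs. A rooted binary hierarchy $H$ on $V$ is a rooted tree whose leaves are the vertices of $V$ and whose internal nodes have exactly two children; $C_H(x,y)$ is the set of leaves below the lowest common ancestor of $x,y$; $h_H(x,x)=0$ and $h_H(x,y)=|C_H(x,y)|-1$ for $x\ne y$. $\operatorname{OPT}_{\mathrm{card}}(G,w)$ is the minimum of $\sum_{xy\in E}w_{xy}h_H(x,y)$ over all rooted binary hierarchies $H$ on $V$ with $h_H\ge d_G$ on all pairs. -}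

module Defs where

open import Algebra.Bundles using (RawMonoid)
open import Data.Bool using (Bool; true; false; T; _∧_; _∨_; not; if_then_else_)
open import Data.Fin as Fin using (Fin)
open import Data.Fin.Properties as Fin using ()
open import Data.Fin.Subset as Subset using (Subset; _∈_)
open import Data.Integer as ℤ using (+_)
open import Data.List as List using (List; []; _∷_)
open import Data.List.Relation.Binary.Permutation.Propositional using (_↭_)
open import Data.List.Relation.Unary.Unique.Propositional using (Unique)
open import Data.Nat as ℕ using (ℕ; zero; suc)
open import Data.Nat.Properties as ℕ using ()
open import Data.Product using (Σ; Σ-syntax; ∃; ∃-syntax; _×_; _,_; proj₁; proj₂)
open import Data.Rational as ℚ using (ℚ; 0ℚ; 1ℚ; ½; ∣_∣)
open import Data.Rational.Properties as ℚ using ()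
open import Data.Rational.Solver using (module +-*-Solver)
open import Data.Sum using (inj₁; inj₂)
open import Data.Tree.Binary using (Tree; leaf; node; module Leaves)
open import Data.Unit using (⊤)
open import Data.Vec as Vec using ()
open import Function using (flip; _∘_)
open import Function.Bundles using (_⇔_)
open import Function.Metric.Structures using (IsGeneralMetric)
open import Level using (0ℓ)
open import Relation.Binary using (Rel; IsEquivalence; IsPartialOrder)
open import Relation.Binary.Construct.Closure.ReflexiveTransitive using (Star; ε; _◅_)
open import Relation.Binary.PropositionalEquality
  using (_≡_; refl; sym; trans; cong; cong₂; subst; subst₂)
open import Relation.Nullary using (¬_; does)

import Algebra.Definitions.RawMonoid as RawMonoidDefs
import Algebra.Definitions.RawSemiring as RawSemiringDefs
import Data.List.Membership.DecPropositional as DecMembership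

fromℕ-ℚ : ℕ → ℚ
fromℕ-ℚ k = + k ℚ./ 1

open RawSemiringDefs ℚ.+-*-rawSemiring public using () renaming (_^_ to _^ℚ_)

open ℚ.≤-Reasoning

private
  variable
    p q r s a b c d e : ℚ

  half : ℚ → ℚ
  half e = ½ ℚ.* e

  recip : ∀ p → 0ℚ ℚ.< p → ℚ
  recip p 0<p = (ℚ.1/ p) {{ℚ.pos⇒nonZero p {{ℚ.positive 0<p}}}}

  abstract
    half+half : ∀ e → half e ℚ.+ half e ≡ e
    half+half e = trans (sym (ℚ.*-distribʳ-+ e ½ ½)) (ℚ.*-identityˡ e)

    *-pos : 0ℚ ℚ.< p → 0ℚ ℚ.< q → 0ℚ ℚ.< p ℚ.* q
    *-pos {p} {q} 0<p 0<q =
      ℚ.positive⁻¹ _ {{ℚ.pos*pos⇒pos p {{ℚ.positive 0<p}} q {{ℚ.positive 0<q}}}}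

    half-pos : 0ℚ ℚ.< e → 0ℚ ℚ.< half e
    half-pos = *-pos (ℚ.positive⁻¹ ½)

    recip-pos : (0<p : 0ℚ ℚ.< p) → 0ℚ ℚ.< recip p 0<p
    recip-pos {p} 0<p = ℚ.positive⁻¹ _ {{ℚ.1/pos⇒pos p {{ℚ.positive 0<p}}}}

    recip-inverseʳ : (0<p : 0ℚ ℚ.< p) → p ℚ.* recip p 0<p ≡ 1ℚ
    recip-inverseʳ {p} 0<p = ℚ.*-inverseʳ p {{ℚ.pos⇒nonZero p {{ℚ.positive 0<p}}}}

    *-mono : 0ℚ ℚ.≤ p → 0ℚ ℚ.≤ s → p ℚ.≤ q → r ℚ.≤ s → p ℚ.* r ℚ.≤ q ℚ.* s
    *-mono {p} {s} {q} {r} 0≤p 0≤s p≤q r≤s = begin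
      p ℚ.* r  ≤⟨ ℚ.*-monoˡ-≤-nonNeg p {{ℚ.nonNegative 0≤p}} r≤s ⟩
      p ℚ.* s  ≤⟨ ℚ.*-monoʳ-≤-nonNeg s {{ℚ.nonNegative 0≤s}} p≤q ⟩
      q ℚ.* s  ∎

    recip-anti : (0<p : 0ℚ ℚ.< p) (0<q : 0ℚ ℚ.< q) → p ℚ.≤ q → recip q 0<q ℚ.≤ recip p 0<p
    recip-anti {p} {q} 0<p 0<q p≤q = ℚ.*-cancelˡ-≤-pos p {{ℚ.positive 0<p}} (begin
      p ℚ.* recip q 0<q  ≤⟨ *-mono (ℚ.<⇒≤ 0<p) (ℚ.<⇒≤ (recip-pos 0<q)) p≤q ℚ.≤-refl ⟩
      q ℚ.* recip q 0<q  ≡⟨ recip-inverseʳ 0<q ⟩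
      1ℚ                 ≡⟨ recip-inverseʳ 0<p ⟨
      p ℚ.* recip p 0<p  ∎)

    p≤∣p∣ : ∀ p → p ℚ.≤ ∣ p ∣
    p≤∣p∣ p with ℚ.≤-total 0ℚ p
    ... | inj₁ 0≤p = ℚ.≤-reflexive (sym (ℚ.0≤p⇒∣p∣≡p 0≤p))
    ... | inj₂ p≤0 = ℚ.≤-trans p≤0 (ℚ.0≤∣p∣ p)

    ∣p-q∣≡∣q-p∣ : ∀ p q → ∣ p ℚ.- q ∣ ≡ ∣ q ℚ.- p ∣
    ∣p-q∣≡∣q-p∣ p q = trans (sym (ℚ.∣-p∣≡∣p∣ (p ℚ.- q)))
      (cong ∣_∣ (solve 2 (λ p q → :- (p :- q) := q :- p) refl p q))
      where open +-*-Solver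

    close⇒≤ : ∀ p q → ∣ p ℚ.- q ∣ ℚ.≤ e → p ℚ.≤ q ℚ.+ e
    close⇒≤ {e} p q h = begin
      p                    ≡⟨ solve 2 (λ p q → p := q :+ (p :- q)) refl p q ⟩
      q ℚ.+ (p ℚ.- q)      ≤⟨ ℚ.+-monoʳ-≤ q (p≤∣p∣ (p ℚ.- q)) ⟩
      q ℚ.+ ∣ p ℚ.- q ∣    ≤⟨ ℚ.+-monoʳ-≤ q h ⟩
      q ℚ.+ e              ∎
      where open +-*-Solver

    ≤⇒close : ∀ p q → p ℚ.≤ q ℚ.+ e → q ℚ.≤ p ℚ.+ e → ∣ p ℚ.- q ∣ ℚ.≤ e
    ≤⇒close {e} p q p≤q+e q≤p+e with ℚ.∣p∣≡p∨∣p∣≡-p (p ℚ.- q)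
    ... | inj₁ eq = subst (ℚ._≤ e) (sym eq) (begin
      p ℚ.- q              ≤⟨ ℚ.+-monoˡ-≤ (ℚ.- q) p≤q+e ⟩
      q ℚ.+ e ℚ.- q        ≡⟨ solve 2 (λ q e → q :+ e :- q := e) refl q e ⟩
      e                    ∎)
      where open +-*-Solver
    ... | inj₂ eq = subst (ℚ._≤ e) (sym eq) (begin
      ℚ.- (p ℚ.- q)        ≡⟨ solve 2 (λ p q → :- (p :- q) := q :- p) refl p q ⟩
      q ℚ.- p              ≤⟨ ℚ.+-monoˡ-≤ (ℚ.- p) q≤p+e ⟩
      p ℚ.+ e ℚ.- p        ≡⟨ solve 2 (λ q e → q :+ e :- q := e) refl p e ⟩
      e                    ∎)
      where open +-*-Solver

    close-trans : ∀ p q r → ∣ p ℚ.- q ∣ ℚ.≤ d → ∣ q ℚ.- r ∣ ℚ.≤ e → ∣ p ℚ.- r ∣ ℚ.≤ d ℚ.+ e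
    close-trans {d} {e} p q r pq qr = begin
      ∣ p ℚ.- r ∣                      ≡⟨ cong ∣_∣ (solve 3 (λ p q r → p :- r := (p :- q) :+ (q :- r)) refl p q r) ⟩
      ∣ (p ℚ.- q) ℚ.+ (q ℚ.- r) ∣      ≤⟨ ℚ.∣p+q∣≤∣p∣+∣q∣ (p ℚ.- q) (q ℚ.- r) ⟩
      ∣ p ℚ.- q ∣ ℚ.+ ∣ q ℚ.- r ∣      ≤⟨ ℚ.+-mono-≤ pq qr ⟩
      d ℚ.+ e                          ∎
      where open +-*-Solver

    +-close : ∀ a b c s → ∣ a ℚ.- c ∣ ℚ.≤ d → ∣ b ℚ.- s ∣ ℚ.≤ e → ∣ (a ℚ.+ b) ℚ.- (c ℚ.+ s) ∣ ℚ.≤ d ℚ.+ e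
    +-close {d} {e} a b c s ac bs = begin
      ∣ (a ℚ.+ b) ℚ.- (c ℚ.+ s) ∣      ≡⟨ cong ∣_∣ (solve 4 (λ a b c s → (a :+ b) :- (c :+ s) := (a :- c) :+ (b :- s)) refl a b c s) ⟩
      ∣ (a ℚ.- c) ℚ.+ (b ℚ.- s) ∣      ≤⟨ ℚ.∣p+q∣≤∣p∣+∣q∣ (a ℚ.- c) (b ℚ.- s) ⟩
      ∣ a ℚ.- c ∣ ℚ.+ ∣ b ℚ.- s ∣      ≤⟨ ℚ.+-mono-≤ ac bs ⟩
      d ℚ.+ e                          ∎
      where open +-*-Solver

    *-close : ∀ a b c s → ∣ a ∣ ℚ.≤ p → ∣ s ∣ ℚ.≤ q → ∣ a ℚ.- c ∣ ℚ.≤ e → ∣ b ℚ.- s ∣ ℚ.≤ e →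
              ∣ (a ℚ.* b) ℚ.- (c ℚ.* s) ∣ ℚ.≤ (p ℚ.+ q) ℚ.* e
    *-close {p} {q} {e} a b c s a≤p s≤q ac bs = begin
      ∣ (a ℚ.* b) ℚ.- (c ℚ.* s) ∣
        ≡⟨ cong ∣_∣ (solve 4 (λ a b c s → (a :* b) :- (c :* s) := a :* (b :- s) :+ s :* (a :- c)) refl a b c s) ⟩
      ∣ a ℚ.* (b ℚ.- s) ℚ.+ s ℚ.* (a ℚ.- c) ∣
        ≤⟨ ℚ.∣p+q∣≤∣p∣+∣q∣ (a ℚ.* (b ℚ.- s)) (s ℚ.* (a ℚ.- c)) ⟩
      ∣ a ℚ.* (b ℚ.- s) ∣ ℚ.+ ∣ s ℚ.* (a ℚ.- c) ∣
        ≡⟨ cong₂ ℚ._+_ (ℚ.∣p*q∣≡∣p∣*∣q∣ a (b ℚ.- s)) (ℚ.∣p*q∣≡∣p∣*∣q∣ s (a ℚ.- c)) ⟩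
      ∣ a ∣ ℚ.* ∣ b ℚ.- s ∣ ℚ.+ ∣ s ∣ ℚ.* ∣ a ℚ.- c ∣
        ≤⟨ ℚ.+-mono-≤ (*-mono (ℚ.0≤∣p∣ a) 0≤e a≤p bs) (*-mono (ℚ.0≤∣p∣ s) 0≤e s≤q ac) ⟩
      p ℚ.* e ℚ.+ q ℚ.* e
        ≡⟨ ℚ.*-distribʳ-+ e p q ⟨
      (p ℚ.+ q) ℚ.* e ∎
      where
      open +-*-Solver
      0≤e : 0ℚ ℚ.≤ e
      0≤e = ℚ.≤-trans (ℚ.0≤∣p∣ (a ℚ.- c)) ac

    ⊔-≤ : ∀ a b c s → a ℚ.≤ c ℚ.+ e → b ℚ.≤ s ℚ.+ e → a ℚ.⊔ b ℚ.≤ (c ℚ.⊔ s) ℚ.+ e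
    ⊔-≤ {e} a b c s ac bs = ℚ.⊔-lub
      (ℚ.≤-trans ac (ℚ.+-monoˡ-≤ e (ℚ.p≤p⊔q c s)))
      (ℚ.≤-trans bs (ℚ.+-monoˡ-≤ e (ℚ.p≤q⊔p c s)))

    ⊔-close : ∀ a b c s → ∣ a ℚ.- c ∣ ℚ.≤ e → ∣ b ℚ.- s ∣ ℚ.≤ e → ∣ (a ℚ.⊔ b) ℚ.- (c ℚ.⊔ s) ∣ ℚ.≤ e
    ⊔-close {e} a b c s ac bs = ≤⇒close (a ℚ.⊔ b) (c ℚ.⊔ s)
      (⊔-≤ a b c s (close⇒≤ a c ac) (close⇒≤ b s bs))
      (⊔-≤ c s a b (close⇒≤ c a (subst (ℚ._≤ e) (∣p-q∣≡∣q-p∣ a c) ac))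
                   (close⇒≤ s b (subst (ℚ._≤ e) (∣p-q∣≡∣q-p∣ b s) bs)))

    recip-close : (0<d : 0ℚ ℚ.< d) (0<p : 0ℚ ℚ.< p) (0<q : 0ℚ ℚ.< q) → d ℚ.≤ p → d ℚ.≤ q →
                  ∣ p ℚ.- q ∣ ℚ.≤ e →
                  ∣ recip p 0<p ℚ.- recip q 0<q ∣ ℚ.≤ (recip d 0<d ℚ.* recip d 0<d) ℚ.* e
    recip-close {d} {p} {q} {e} 0<d 0<p 0<q d≤p d≤q pq = begin
      ∣ p' ℚ.- q' ∣
        ≡⟨ cong ∣_∣ (cong₂ ℚ._-_ (sym (ℚ.*-identityʳ p')) (sym (ℚ.*-identityʳ q'))) ⟩
      ∣ p' ℚ.* 1ℚ ℚ.- q' ℚ.* 1ℚ ∣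
        ≡⟨ cong ∣_∣ (cong₂ (λ u v → p' ℚ.* u ℚ.- q' ℚ.* v) (recip-inverseʳ 0<q) (recip-inverseʳ 0<p)) ⟨
      ∣ p' ℚ.* (q ℚ.* q') ℚ.- q' ℚ.* (p ℚ.* p') ∣
        ≡⟨ cong ∣_∣ (solve 4 (λ p q p' q' → p' :* (q :* q') :- q' :* (p :* p') := (p' :* q') :* (q :- p)) refl p q p' q') ⟩
      ∣ (p' ℚ.* q') ℚ.* (q ℚ.- p) ∣
        ≡⟨ ℚ.∣p*q∣≡∣p∣*∣q∣ (p' ℚ.* q') (q ℚ.- p) ⟩
      ∣ p' ℚ.* q' ∣ ℚ.* ∣ q ℚ.- p ∣
        ≡⟨ cong₂ ℚ._*_ (ℚ.0≤p⇒∣p∣≡p 0≤p'q') (∣p-q∣≡∣q-p∣ q p) ⟩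
      (p' ℚ.* q') ℚ.* ∣ p ℚ.- q ∣
        ≤⟨ *-mono 0≤p'q' (ℚ.≤-trans (ℚ.0≤∣p∣ (p ℚ.- q)) pq)
             (*-mono (ℚ.<⇒≤ (recip-pos 0<p)) (ℚ.<⇒≤ (recip-pos 0<d))
               (recip-anti 0<d 0<p d≤p) (recip-anti 0<d 0<q d≤q))
             pq ⟩
      (recip d 0<d ℚ.* recip d 0<d) ℚ.* e ∎
      where
      open +-*-Solver
      p' q' : ℚ
      p' = recip p 0<p
      q' = recip q 0<q
      0≤p'q' : 0ℚ ℚ.≤ p' ℚ.* q'
      0≤p'q' = ℚ.<⇒≤ (*-pos (recip-pos 0<p) (recip-pos 0<q))

    *-recip-cancel : (0<p : 0ℚ ℚ.< p) → p ℚ.* (recip p 0<p ℚ.* e) ≡ e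
    *-recip-cancel {p} {e} 0<p = trans (sym (ℚ.*-assoc p (recip p 0<p) e))
      (trans (cong (ℚ._* e) (recip-inverseʳ 0<p)) (ℚ.*-identityˡ e))

    recip²-cancel : (0<d : 0ℚ ℚ.< d) → (recip d 0<d ℚ.* recip d 0<d) ℚ.* ((d ℚ.* d) ℚ.* e) ≡ e
    recip²-cancel {d} {e} 0<d = begin-equality
      (d' ℚ.* d') ℚ.* ((d ℚ.* d) ℚ.* e)
        ≡⟨ solve 3 (λ d d' e → (d' :* d') :* ((d :* d) :* e) := (d :* d') :* ((d :* d') :* e)) refl d d' e ⟩
      (d ℚ.* d') ℚ.* ((d ℚ.* d') ℚ.* e)
        ≡⟨ cong (λ u → u ℚ.* (u ℚ.* e)) (recip-inverseʳ 0<d) ⟩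
      1ℚ ℚ.* (1ℚ ℚ.* e)
        ≡⟨ ℚ.*-identityˡ (1ℚ ℚ.* e) ⟩
      1ℚ ℚ.* e
        ≡⟨ ℚ.*-identityˡ e ⟩
      e ∎
      where
      open +-*-Solver
      d' : ℚ
      d' = recip d 0<d

    recip-⊔-close : ∀ d a b (0<d : 0ℚ ℚ.< d) (0<p : 0ℚ ℚ.< d ℚ.⊔ a) (0<q : 0ℚ ℚ.< d ℚ.⊔ b) →
                    ∣ a ℚ.- b ∣ ℚ.≤ (d ℚ.* d) ℚ.* e →
                    ∣ recip (d ℚ.⊔ a) 0<p ℚ.- recip (d ℚ.⊔ b) 0<q ∣ ℚ.≤ e
    recip-⊔-close {e} d a b 0<d 0<p 0<q ab = begin
      ∣ recip (d ℚ.⊔ a) 0<p ℚ.- recip (d ℚ.⊔ b) 0<q ∣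
        ≤⟨ recip-close 0<d 0<p 0<q (ℚ.p≤p⊔q d a) (ℚ.p≤p⊔q d b) (⊔-close d a d b dd ab) ⟩
      (recip d 0<d ℚ.* recip d 0<d) ℚ.* ((d ℚ.* d) ℚ.* e)
        ≡⟨ recip²-cancel 0<d ⟩
      e ∎
      where
      dd : ∣ d ℚ.- d ∣ ℚ.≤ (d ℚ.* d) ℚ.* e
      dd = ℚ.≤-trans (ℚ.≤-reflexive (cong ∣_∣ (ℚ.+-inverseʳ d)))
             (ℚ.≤-trans (ℚ.0≤∣p∣ (a ℚ.- b)) ab)

Eventually : (ℕ → Set) → Set
Eventually P = ∃[ N ] ∀ n → N ℕ.≤ n → P n

Eventually-map₂ : ∀ {P Q R : ℕ → Set} → (∀ n → P n → Q n → R n) →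
                  Eventually P → Eventually Q → Eventually R
Eventually-map₂ f (N , hP) (M , hQ) = N ℕ.⊔ M , λ n le →
  f n (hP n (ℕ.≤-trans (ℕ.m≤m⊔n N M) le)) (hQ n (ℕ.≤-trans (ℕ.m≤n⊔m N M) le))

IsCauchy : (ℕ → ℚ) → Set
IsCauchy x = ∀ e → 0ℚ ℚ.< e →
  ∃[ N ] ∀ m n → N ℕ.≤ m → N ℕ.≤ n → ∣ x m ℚ.- x n ∣ ℚ.≤ e

-- Real numbers are Cauchy sequences of rationals, up to the equality _≃_.
record ℝ : Set where
  constructor mkℝ
  field
    seq    : ℕ → ℚ
    cauchy : IsCauchy seq

open ℝ public

infix 4 _≃_ _≤_ _<_
infixl 6 _+_
infixl 7 _*_ _÷_[_] _÷ℕ_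
infixl 6 _⊔_

_≃_ : Rel ℝ 0ℓ
x ≃ y = ∀ e → 0ℚ ℚ.< e → Eventually λ n → ∣ seq x n ℚ.- seq y n ∣ ℚ.≤ e

_≤_ : Rel ℝ 0ℓ
x ≤ y = ∀ e → 0ℚ ℚ.< e → Eventually λ n → seq x n ℚ.≤ seq y n ℚ.+ e

_<_ : Rel ℝ 0ℓ
x < y = ∃[ e ] 0ℚ ℚ.< e × Eventually λ n → seq x n ℚ.+ e ℚ.≤ seq y n

fromℚ : ℚ → ℝ
fromℚ p = mkℝ (λ _ → p) λ e 0<e → 0 , λ _ _ _ _ →
  subst (ℚ._≤ e) (cong ∣_∣ (sym (ℚ.+-inverseʳ p))) (ℚ.<⇒≤ 0<e)

fromℕ : ℕ → ℝ
fromℕ k = fromℚ (fromℕ-ℚ k)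

0ℝ : ℝ
0ℝ = fromℚ 0ℚ

private abstract
  bound : ∀ x → ∃[ B ] 0ℚ ℚ.< B × Eventually λ n → ∣ seq x n ∣ ℚ.≤ B
  bound (mkℝ x cx) with cx 1ℚ (ℚ.positive⁻¹ 1ℚ)
  ... | N , h = 1ℚ ℚ.+ ∣ x N ∣
    , ℚ.+-mono-<-≤ (ℚ.positive⁻¹ 1ℚ) (ℚ.0≤∣p∣ (x N))
    , N , λ n N≤n → begin
        ∣ x n ∣                        ≡⟨ cong ∣_∣ (solve 2 (λ p q → p := (p :- q) :+ q) refl (x n) (x N)) ⟩
        ∣ (x n ℚ.- x N) ℚ.+ x N ∣      ≤⟨ ℚ.∣p+q∣≤∣p∣+∣q∣ (x n ℚ.- x N) (x N) ⟩
        ∣ x n ℚ.- x N ∣ ℚ.+ ∣ x N ∣    ≤⟨ ℚ.+-monoˡ-≤ ∣ x N ∣ (h n N N≤n ℕ.≤-refl) ⟩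
        1ℚ ℚ.+ ∣ x N ∣                 ∎
    where open +-*-Solver

  cauchy₂ : ∀ (x y : ℝ) → ∀ d → 0ℚ ℚ.< d → ∃[ N ] ∀ m n → N ℕ.≤ m → N ℕ.≤ n →
            (∣ seq x m ℚ.- seq x n ∣ ℚ.≤ d) × (∣ seq y m ℚ.- seq y n ∣ ℚ.≤ d)
  cauchy₂ x y d 0<d with cauchy x d 0<d | cauchy y d 0<d
  ... | N , hx | M , hy = N ℕ.⊔ M , λ m n Nm Nn →
    hx m n (ℕ.≤-trans (ℕ.m≤m⊔n N M) Nm) (ℕ.≤-trans (ℕ.m≤m⊔n N M) Nn) ,
    hy m n (ℕ.≤-trans (ℕ.m≤n⊔m N M) Nm) (ℕ.≤-trans (ℕ.m≤n⊔m N M) Nn)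

  +-cauchy : ∀ x y → IsCauchy (λ n → seq x n ℚ.+ seq y n)
  +-cauchy x y e 0<e =
    let N , h = cauchy₂ x y (half e) (half-pos 0<e) in
    N , λ m n Nm Nn → subst (_ ℚ.≤_) (half+half e)
      (+-close (seq x m) (seq y m) (seq x n) (seq y n)
        (proj₁ (h m n Nm Nn)) (proj₂ (h m n Nm Nn)))

  *-cauchy : ∀ x y → IsCauchy (λ n → seq x n ℚ.* seq y n)
  *-cauchy x y e 0<e =
    let B , 0<B , K , hB = bound x
        C , 0<C , L , hC = bound y
        0<B+C = ℚ.+-mono-< 0<B 0<C
        N , h = cauchy₂ x y (recip (B ℚ.+ C) 0<B+C ℚ.* e) (*-pos (recip-pos 0<B+C) 0<e)
        M = (K ℕ.⊔ L) ℕ.⊔ N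
        N≤M = ℕ.m≤n⊔m (K ℕ.⊔ L) N
        K≤M = ℕ.≤-trans (ℕ.m≤m⊔n K L) (ℕ.m≤m⊔n (K ℕ.⊔ L) N)
        L≤M = ℕ.≤-trans (ℕ.m≤n⊔m K L) (ℕ.m≤m⊔n (K ℕ.⊔ L) N)
    in M , λ m n Mm Mn →
      let hx , hy = h m n (ℕ.≤-trans N≤M Mm) (ℕ.≤-trans N≤M Mn) in
      subst (_ ℚ.≤_) (*-recip-cancel 0<B+C)
        (*-close (seq x m) (seq y m) (seq x n) (seq y n)
          (hB m (ℕ.≤-trans K≤M Mm)) (hC n (ℕ.≤-trans L≤M Mn)) hx hy)

  ⊔-cauchy : ∀ x y → IsCauchy (λ n → seq x n ℚ.⊔ seq y n)
  ⊔-cauchy x y e 0<e =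
    let N , h = cauchy₂ x y e 0<e in
    N , λ m n Nm Nn → ⊔-close (seq x m) (seq y m) (seq x n) (seq y n)
      (proj₁ (h m n Nm Nn)) (proj₂ (h m n Nm Nn))

  0<d⊔p : ∀ {d} p → 0ℚ ℚ.< d → 0ℚ ℚ.< d ℚ.⊔ p
  0<d⊔p {d} p 0<d = ℚ.<-≤-trans 0<d (ℚ.p≤p⊔q d p)

  recip-cauchy : ∀ y d (0<d : 0ℚ ℚ.< d) →
                 IsCauchy (λ n → recip (d ℚ.⊔ seq y n) (0<d⊔p (seq y n) 0<d))
  recip-cauchy y d 0<d e 0<e =
    let N , h = cauchy y ((d ℚ.* d) ℚ.* e) (*-pos (*-pos 0<d 0<d) 0<e) in
    N , λ m n Nm Nn → recip-⊔-close d (seq y m) (seq y n) 0<d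
      (0<d⊔p (seq y m) 0<d) (0<d⊔p (seq y n) 0<d) (h m n Nm Nn)

_+_ : ℝ → ℝ → ℝ
x + y = mkℝ (λ n → seq x n ℚ.+ seq y n) (+-cauchy x y)

_*_ : ℝ → ℝ → ℝ
x * y = mkℝ (λ n → seq x n ℚ.* seq y n) (*-cauchy x y)

_⊔_ : ℝ → ℝ → ℝ
x ⊔ y = mkℝ (λ n → seq x n ℚ.⊔ seq y n) (⊔-cauchy x y)

-- The terms are cut off below at the witness d of positivity, which they
-- eventually exceed, so that every one of them is invertible.
inverse : ∀ y → 0ℝ < y → ℝ
inverse y (d , 0<d , _) =
  mkℝ (λ n → recip (d ℚ.⊔ seq y n) (0<d⊔p (seq y n) 0<d)) (recip-cauchy y d 0<d)

_÷_[_] : ∀ (x y : ℝ) → 0ℝ < y → ℝ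
x ÷ y [ 0<y ] = x * inverse y 0<y

_÷ℕ_ : ∀ (x : ℝ) (k : ℕ) → .{{ℕ.NonZero k}} → ℝ
x ÷ℕ k = x * fromℚ (+ 1 ℚ./ k)

≃-isEquivalence : IsEquivalence _≃_
≃-isEquivalence = record
  { refl  = λ {x} e 0<e → 0 , λ n _ →
      subst (ℚ._≤ e) (cong ∣_∣ (sym (ℚ.+-inverseʳ (seq x n)))) (ℚ.<⇒≤ 0<e)
  ; sym   = λ {x} {y} xy e 0<e → proj₁ (xy e 0<e) , λ n le →
      subst (ℚ._≤ e) (∣p-q∣≡∣q-p∣ (seq x n) (seq y n)) (proj₂ (xy e 0<e) n le)
  ; trans = λ {x} {y} {z} xy yz e 0<e → Eventually-map₂
      (λ n p q → subst (_ ℚ.≤_) (half+half e) (close-trans (seq x n) (seq y n) (seq z n) p q))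
      (xy (half e) (half-pos 0<e)) (yz (half e) (half-pos 0<e))
  }

≤-isPartialOrder : IsPartialOrder _≃_ _≤_
≤-isPartialOrder = record
  { isPreorder = record
    { isEquivalence = ≃-isEquivalence
    ; reflexive     = λ {x} {y} xy e 0<e → proj₁ (xy e 0<e) , λ n le →
        close⇒≤ (seq x n) (seq y n) (proj₂ (xy e 0<e) n le)
    ; trans         = λ {x} {y} {z} xy yz e 0<e → Eventually-map₂
        (λ n p q → begin
          seq x n                              ≤⟨ p ⟩
          seq y n ℚ.+ half e                   ≤⟨ ℚ.+-monoˡ-≤ (half e) q ⟩
          seq z n ℚ.+ half e ℚ.+ half e        ≡⟨ ℚ.+-assoc (seq z n) (half e) (half e) ⟩
          seq z n ℚ.+ (half e ℚ.+ half e)      ≡⟨ cong (seq z n ℚ.+_) (half+half e) ⟩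
          seq z n ℚ.+ e                        ∎)
        (xy (half e) (half-pos 0<e)) (yz (half e) (half-pos 0<e))
    }
  ; antisym = λ {x} {y} xy yx e 0<e →
      Eventually-map₂ (λ n → ≤⇒close (seq x n) (seq y n)) (xy e 0<e) (yx e 0<e)
  }

*-inverseʳ : ∀ y (0<y : 0ℝ < y) → y * inverse y 0<y ≃ fromℚ 1ℚ
*-inverseʳ y (d , 0<d , N , d≤y) e 0<e = N , λ n N≤n →
  let yₙ = seq y n
      r  = recip (d ℚ.⊔ yₙ) (0<d⊔p yₙ 0<d)
      d⊔yₙ≡yₙ = ℚ.p≤q⇒p⊔q≡q (subst (ℚ._≤ yₙ) (ℚ.+-identityˡ d) (d≤y n N≤n))
  in begin
    ∣ yₙ ℚ.* r ℚ.- 1ℚ ∣          ≡⟨ cong (λ u → ∣ u ℚ.* r ℚ.- 1ℚ ∣) d⊔yₙ≡yₙ ⟨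
    ∣ (d ℚ.⊔ yₙ) ℚ.* r ℚ.- 1ℚ ∣  ≡⟨ cong (λ u → ∣ u ℚ.- 1ℚ ∣) (recip-inverseʳ (0<d⊔p yₙ 0<d)) ⟩
    0ℚ                           ≤⟨ ℚ.<⇒≤ 0<e ⟩
    e                            ∎

+-0-rawMonoid : RawMonoid 0ℓ 0ℓ
+-0-rawMonoid = record { Carrier = ℝ ; _≈_ = _≃_ ; _∙_ = _+_ ; ε = 0ℝ }

open RawMonoidDefs +-0-rawMonoid public using (sum)

record IsMinimum {A I : Set} (_≈_ _≼_ : Rel I 0ℓ) (f : A → I) (v : I) : Set where
  field
    attained : ∃[ a ] f a ≈ v
    isLower  : ∀ a → v ≼ f a

IsMaximum : {A I : Set} (_≈_ _≼_ : Rel I 0ℓ) (f : A → I) (v : I) → Set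
IsMaximum _≈_ _≼_ = IsMinimum _≈_ (flip _≼_)

-- For b > 1, ⌊log_b x⌋ = k means k ≤ log_b x < k + 1.
record ⌊log_⌋ (b x : ℚ) (k : ℕ) : Set where
  field
    lower : b ^ℚ k ℚ.≤ x
    upper : x ℚ.< b ^ℚ suc k

pred-nonZero : ∀ {k} → 2 ℕ.≤ k → ℕ.NonZero (k ℕ.∸ 1)
pred-nonZero 2≤k = ℕ.>-nonZero (ℕ.m<n⇒0<n∸m 2≤k)

Δ/[Δ-1] : ∀ Δ → 2 ℕ.≤ Δ → ℚ
Δ/[Δ-1] Δ 2≤Δ = (+ Δ ℚ./ (Δ ℕ.∸ 1)) {{pred-nonZero 2≤Δ}}

1-1/Δ : ∀ Δ → 2 ℕ.≤ Δ → ℚ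
1-1/Δ Δ 2≤Δ = 1ℚ ℚ.- (+ 1 ℚ./ Δ) {{ℕ.>-nonZero (ℕ.<-trans ℕ.z<s 2≤Δ)}}

EdgeSet : ℕ → Set
EdgeSet n = Fin n → Fin n → Bool

module _ {n : ℕ} (E : EdgeSet n) where

  Walk : Fin n → Fin n → Set
  Walk = Star (λ x y → T (E x y))

  neighbours : Fin n → Subset n
  neighbours x = Vec.tabulate (E x)

  degree : Fin n → ℕ
  degree x = Subset.∣ neighbours x ∣

  -- Each edge is counted once, with its smaller endpoint first.
  ∑[xy∈_] : (Fin n → Fin n → ℝ) → ℝ
  ∑[xy∈_] f = sum λ x → sum λ y →
    if does (x Fin.<? y) ∧ E x y then f x y else 0ℝ

  removeEdge : Fin n → Fin n → EdgeSet n
  removeEdge a b x y = E x y ∧ not ((x ≡ᵇ a ∧ y ≡ᵇ b) ∨ (x ≡ᵇ b ∧ y ≡ᵇ a))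
    where
    infix 7 _≡ᵇ_
    _≡ᵇ_ : Fin n → Fin n → Bool
    x ≡ᵇ y = does (x Fin.≟ y)

  IsComponentOf : Fin n → Subset n → Set
  IsComponentOf a A = ∀ x → x ∈ A ⇔ Walk a x

module _ {n : ℕ} {E : EdgeSet n} where

  vertices : ∀ {x y} → Walk E x y → List (Fin n)
  vertices {x} ε       = x ∷ []
  vertices {x} (_ ◅ p) = x ∷ vertices p

  length : ∀ {x y} → Walk E x y → ℕ
  length ε       = 0
  length (_ ◅ p) = suc (length p)

-- E(G[S]); the vertices outside S are kept, but isolated.
induced : ∀ {n} → EdgeSet n → Subset n → EdgeSet n
induced E S x y = E x y ∧ Vec.lookup S x ∧ Vec.lookup S y

ConnectedOn : ∀ {n} → EdgeSet n → Subset n → Set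
ConnectedOn E S = ∀ {x y} → x ∈ S → y ∈ S → Walk (induced E S) x y

-- A cycle is an edge xy closed up by a path of length at least 2 from y to x.
Acyclic : ∀ {n} → EdgeSet n → Set
Acyclic E = ∀ {x y} → T (E x y) → (p : Walk E y x) →
  Unique (vertices p) → ¬ (2 ℕ.≤ length p)

-- Weights are only meaningful on edges.
record WeightedGraph (n : ℕ) : Set where
  field
    E       : EdgeSet n
    E-sym   : ∀ x y → E x y ≡ E y x
    E-irr   : ∀ x → E x x ≡ false
    w       : Fin n → Fin n → ℝ
    w-sym   : ∀ {x y} → T (E x y) → w x y ≃ w y x
    w-pos   : ∀ {x y} → T (E x y) → 0ℝ < w x y

module _ {n : ℕ} (G : WeightedGraph n) where
  open WeightedGraph G

  record IsTree : Set where
    field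
      connected : ∀ x y → Walk E x y
      acyclic   : Acyclic E

  MaxDegree≤ : ℕ → Set
  MaxDegree≤ Δ = ∀ x → degree E x ℕ.≤ Δ

  W : Subset n → ℝ
  W S = ∑[xy∈ induced E S ] w

  Edge : Set
  Edge = Σ[ x ∈ Fin n ] Σ[ y ∈ Fin n ] T (E x y)

  weight : Edge → ℝ
  weight (x , y , _) = w x y

  IsMaxWeight IsMinWeight : ℝ → Set
  IsMaxWeight = IsMaximum _≃_ _≤_ weight
  IsMinWeight = IsMinimum _≃_ _≤_ weight

  IsDistance : Fin n → Fin n → ℕ → Set
  IsDistance x y = IsMinimum _≡_ ℕ._≤_ (length {E = E} {x} {y})

  -- The ordinary triangle inequality follows from the strong one and
  -- nonnegativity.
  IsUltrametric : (Fin n → Fin n → ℝ) → Set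
  IsUltrametric = IsGeneralMetric _≡_ _≃_ _≤_ 0ℝ _⊔_

  record FeasibleUltrametric : Set where
    field
      u             : Fin n → Fin n → ℝ
      isUltrametric : IsUltrametric u
      u≥d           : ∀ x y d → IsDistance x y d → fromℕ d ≤ u x y

  freeCost : FeasibleUltrametric → ℝ
  freeCost U = ∑[xy∈ E ] λ x y → w x y * FeasibleUltrametric.u U x y

  IsOPTfree : ℝ → Set
  IsOPTfree = IsMinimum _≃_ _≤_ freeCost

-- The order of the two children of a node plays no role below.
record Hierarchy (n : ℕ) : Set where
  field
    tree   : Tree ⊤ (Fin n)
    leaves : Leaves.toList tree ↭ List.allFin n

module _ {n : ℕ} where
  open DecMembership (Fin._≟_ {n}) using () renaming (_∈?_ to _∈ᴸ?_)

  both : Fin n → Fin n → Tree ⊤ (Fin n) → Bool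
  both x y t = does (x ∈ᴸ? Leaves.toList t) ∧ does (y ∈ᴸ? Leaves.toList t)

  -- The subtree rooted at the lowest common ancestor of x and y.
  lca : Tree ⊤ (Fin n) → Fin n → Fin n → Tree ⊤ (Fin n)
  lca (leaf v)     x y = leaf v
  lca (node l _ r) x y =
    if both x y l then lca l x y else
    if both x y r then lca r x y else
    node l _ r

  C : Hierarchy n → Fin n → Fin n → List (Fin n)
  C H x y = Leaves.toList (lca (Hierarchy.tree H) x y)

  h : Hierarchy n → Fin n → Fin n → ℕ
  h H x y = if does (x Fin.≟ y) then 0 else List.length (C H x y) ℕ.∸ 1

module _ {n : ℕ} (G : WeightedGraph n) where
  open WeightedGraph G

  record FeasibleHierarchy : Set where
    field
      H   : Hierarchy n
      h≥d : ∀ x y d → IsDistance G x y d → d ℕ.≤ h H x y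

  cardCost : FeasibleHierarchy → ℝ
  cardCost F = ∑[xy∈ E ] λ x y → w x y * fromℕ (h (FeasibleHierarchy.H F) x y)

  IsOPTcard : ℝ → Set
  IsOPTcard = IsMinimum _≃_ _≤_ cardCost

  record BalancedLightEdge (Δ : ℕ) (2≤Δ : 2 ℕ.≤ Δ) (Λ : ℝ)
                           (S : Subset n) (2≤∣S∣ : 2 ℕ.≤ Subset.∣ S ∣) : Set where
    field
      x y      : Fin n
      xy∈G[S]  : T (induced E S x y)
      A B      : Subset n
      A-comp   : IsComponentOf (removeEdge (induced E S) x y) x A
      B-comp   : IsComponentOf (removeEdge (induced E S) x y) y B
      balanced : fromℕ-ℚ ((Subset.∣ A ∣ ℕ.∸ 1) ℕ.⊔ (Subset.∣ B ∣ ℕ.∸ 1))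
                   ℚ.≤ 1-1/Δ Δ 2≤Δ ℚ.* fromℕ-ℚ (Subset.∣ S ∣ ℕ.∸ 1)
      light    : w x y ≤ Λ * (W G S ÷ℕ (Subset.∣ S ∣ ℕ.∸ 1)) {{pred-nonZero 2≤∣S∣}}

  HasBalancedLightEdges : (Δ : ℕ) → 2 ℕ.≤ Δ → ℝ → Set
  HasBalancedLightEdges Δ 2≤Δ Λ = ∀ S → ConnectedOn E S →
    (2≤∣S∣ : 2 ℕ.≤ Subset.∣ S ∣) → BalancedLightEdge Δ 2≤Δ Λ S 2≤∣S∣

  WeightSpread≤ : ℝ → Set
  WeightSpread≤ Λ = ∃[ M ] ∃[ m ] IsMaxWeight G M × IsMinWeight G m ×
    Σ[ 0<m ∈ 0ℝ < m ] M ÷ m [ 0<m ] ≤ Λ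

  RatioBound : (Δ : ℕ) → 2 ℕ.≤ Δ → ℝ → Set
  RatioBound Δ 2≤Δ Λ = ∀ card free k →
    IsOPTcard card → IsOPTfree G free →
    ⌊log Δ/[Δ-1] Δ 2≤Δ ⌋ (fromℕ-ℚ (n ℕ.∸ 1)) k →
    Σ[ 0<free ∈ 0ℝ < free ] card ÷ free [ 0<free ] ≤ Λ * fromℕ (1 ℕ.+ k)

{-# OPTIONS --safe #-}

-- Idea.  Cut the tree recursively at the balanced light edges.  Cutting S at e_S costs
-- w(e_S)(|S| − 1) ≤ Λ W(S), and the parts met at one depth of the recursion are disjoint, so each
-- depth costs at most Λ W(V).  At depth j a part has |S| − 1 ≤ (1 − 1/Δ)^j (n − 1), so only the depths
-- j ≤ log_{Δ/(Δ−1)} (n − 1) contribute, while OPT_free ≥ W(V) because an admissible ultrametric is at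
-- least 1 on edges.  If the weight spread is at most Λ, every edge of S is light, so a balanced edge
-- is enough: take an edge vu whose side B containing u is minimal subject to Δ|B| ≥ |S| − 1.  That
-- bound keeps the other side small, and by minimality each of the at most Δ − 1 branches hanging
-- from u has fewer than (|S| − 1)/Δ vertices, so |B| − 1 ≤ (1 − 1/Δ)(|S| − 1).

module Submission where

open import Defs
open import Data.Bool using (true; false; T; T?; _∧_; not; if_then_else_)
open import Data.Bool.Properties using (T-∧; T-∨)
open import Data.Fin as Fin using (Fin; zero; suc)
import Data.Fin.Properties as Fin
open import Data.Fin.Subset as Subset using (Subset; _∈_; _∉_; _⊆_; _∪_; inside; outside)
import Data.Fin.Subset.Properties as Subset
open import Data.Integer as ℤ using (+_)
import Data.Integer.Properties as ℤ
open import Data.List as List using (List; []; _∷_)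
import Data.List.Membership.DecPropositional as DecMembership
open import Data.List.Membership.Propositional using () renaming (_∈_ to _∈ᴸ_)
open import Data.List.Membership.Propositional.Properties
  using (∈-++⁺ˡ; ∈-++⁺ʳ; ∈-++⁻; ∈-allFin; ∈-map⁺; ∈-filter⁺)
open import Data.List.Membership.Propositional.Properties.WithK using (unique∧set⇒bag)
import Data.List.Properties as List
open import Data.List.Relation.Binary.BagAndSetEquality using (∼bag⇒↭)
open import Data.List.Relation.Unary.All as All using (All; []; _∷_)
import Data.List.Relation.Unary.All.Properties as All
open import Data.List.Relation.Unary.AllPairs using ([]; _∷_)
open import Data.List.Relation.Unary.Any using (here; there)
open import Data.List.Relation.Unary.Unique.Propositional using (Unique)
import Data.List.Relation.Unary.Unique.Propositional.Properties as Unique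
open import Data.Nat as ℕ using (ℕ; zero; suc) renaming (_≤_ to _≤ℕ_)
import Data.Nat.Properties as ℕ
open import Data.Product using (_×_; _,_; proj₁; proj₂; Σ-syntax; ∃-syntax)
open import Data.Rational as ℚ using (ℚ; 0ℚ; 1ℚ; ½; ∣_∣)
import Data.Rational.Properties as ℚ
open import Data.Rational.Solver using (module +-*-Solver)
import Data.Rational.Unnormalised as ℚᵘ
import Data.Rational.Unnormalised.Properties as ℚᵘ
open import Data.Sum using (_⊎_; inj₁; inj₂; [_,_]′; swap)
open import Data.Tree.Binary using (Tree; leaf; node; module Leaves)
open import Data.Unit using (⊤; tt)
open import Data.Vec as Vec using ([]; _∷_)
import Data.Vec.Properties as Vec
open import Function using (_∘_)
open import Function.Bundles using (mk⇔; module Equivalence)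
open import Relation.Binary using (IsPartialOrder; IsEquivalence; tri<; tri≈; tri>)
open import Relation.Binary.Construct.Closure.ReflexiveTransitive as Star using (ε; _◅_; _◅◅_)
open import Relation.Binary.PropositionalEquality
  using (_≡_; _≢_; refl; sym; trans; cong; cong₂; subst; subst₂; module ≡-Reasoning)
import Relation.Binary.Reasoning.Base.Single as SingleReasoning
open import Relation.Nullary using (¬_; ¬?; Dec; does; yes; no; contradiction; _×-dec_)
open import Relation.Nullary.Decidable as Dec using ()

-- Arithmetic of rationals

private module ≤ = IsPartialOrder ≤-isPartialOrder
private module ℚR = ℚ.≤-Reasoning

0<½ : 0ℚ ℚ.< ½
0<½ = ℚ.positive⁻¹ ½

*-pos : ∀ {p q} → 0ℚ ℚ.< p → 0ℚ ℚ.< q → 0ℚ ℚ.< p ℚ.* q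
*-pos {p} {q} 0<p 0<q =
  ℚ.positive⁻¹ _ {{ℚ.pos*pos⇒pos p {{ℚ.positive 0<p}} q {{ℚ.positive 0<q}}}}

*-nonNeg : ∀ {p q} → 0ℚ ℚ.≤ p → 0ℚ ℚ.≤ q → 0ℚ ℚ.≤ p ℚ.* q
*-nonNeg {p} {q} 0≤p 0≤q = begin
  0ℚ        ≡⟨ ℚ.*-zeroʳ p ⟨
  p ℚ.* 0ℚ  ≤⟨ ℚ.*-monoˡ-≤-nonNeg p {{ℚ.nonNegative 0≤p}} 0≤q ⟩
  p ℚ.* q   ∎
  where open ℚR

half+half : ∀ e → ½ ℚ.* e ℚ.+ ½ ℚ.* e ≡ e
half+half e = trans (sym (ℚ.*-distribʳ-+ e ½ ½)) (ℚ.*-identityˡ e)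

p≤q+p : ∀ {p q} → 0ℚ ℚ.≤ q → p ℚ.≤ q ℚ.+ p
p≤q+p {p} {q} 0≤q = begin
  p          ≡⟨ ℚ.+-identityˡ p ⟨
  0ℚ ℚ.+ p   ≤⟨ ℚ.+-monoˡ-≤ p 0≤q ⟩
  q ℚ.+ p    ∎
  where open ℚR

fromℕ-ℚ-+ : ∀ a b → fromℕ-ℚ (a ℕ.+ b) ≡ fromℕ-ℚ a ℚ.+ fromℕ-ℚ b
fromℕ-ℚ-+ a b = ℚ.toℚᵘ-injective (begin
  ℚ.toℚᵘ (fromℕ-ℚ (a ℕ.+ b))                    ≈⟨ ℚ.toℚᵘ-fromℚᵘ (u (a ℕ.+ b)) ⟩
  u (a ℕ.+ b)
    ≈⟨ ℚᵘ.*≡* (cong (ℤ._* + 1) (cong₂ ℤ._+_ (ℤ.*-identityʳ (+ a)) (ℤ.*-identityʳ (+ b)))) ⟨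
  u a ℚᵘ.+ u b                                  ≈⟨ ℚᵘ.+-cong (ℚ.toℚᵘ-fromℚᵘ (u a)) (ℚ.toℚᵘ-fromℚᵘ (u b)) ⟨
  ℚ.toℚᵘ (fromℕ-ℚ a) ℚᵘ.+ ℚ.toℚᵘ (fromℕ-ℚ b)    ≈⟨ ℚ.toℚᵘ-homo-+ (fromℕ-ℚ a) (fromℕ-ℚ b) ⟨
  ℚ.toℚᵘ (fromℕ-ℚ a ℚ.+ fromℕ-ℚ b)              ∎)
  where
  open ℚᵘ.≃-Reasoning
  u : ℕ → ℚᵘ.ℚᵘ
  u k = ℚᵘ.mkℚᵘ (+ k) 0

*-/-cancel : ∀ n d .{{_ : ℕ.NonZero d}} → fromℕ-ℚ d ℚ.* (+ n ℚ./ d) ≡ fromℕ-ℚ n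
*-/-cancel n (suc d) = ℚ.toℚᵘ-injective (begin
  ℚ.toℚᵘ (fromℕ-ℚ (suc d) ℚ.* (+ n ℚ./ suc d))               ≈⟨ ℚ.toℚᵘ-homo-* (fromℕ-ℚ (suc d)) (+ n ℚ./ suc d) ⟩
  ℚ.toℚᵘ (fromℕ-ℚ (suc d)) ℚᵘ.* ℚ.toℚᵘ (+ n ℚ./ suc d)
    ≈⟨ ℚᵘ.*-cong (ℚ.toℚᵘ-fromℚᵘ (ℚᵘ.mkℚᵘ (+ suc d) 0)) (ℚ.toℚᵘ-fromℚᵘ (ℚᵘ.mkℚᵘ (+ n) d)) ⟩
  ℚᵘ.mkℚᵘ (+ suc d) 0 ℚᵘ.* ℚᵘ.mkℚᵘ (+ n) d
    ≈⟨ ℚᵘ.*≡* (trans (ℤ.*-identityʳ (+ suc d ℤ.* + n)) (trans (ℤ.*-comm (+ suc d) (+ n)) (cong (λ k → + n ℤ.* + suc k) (sym (ℕ.+-identityʳ d))))) ⟩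
  ℚᵘ.mkℚᵘ (+ n) 0                                            ≈⟨ ℚ.toℚᵘ-fromℚᵘ (ℚᵘ.mkℚᵘ (+ n) 0) ⟨
  ℚ.toℚᵘ (fromℕ-ℚ n)                                         ∎)
  where open ℚᵘ.≃-Reasoning

fromℕ-ℚ-* : ∀ a b → fromℕ-ℚ (a ℕ.* b) ≡ fromℕ-ℚ a ℚ.* fromℕ-ℚ b
fromℕ-ℚ-* zero    b = sym (ℚ.*-zeroˡ (fromℕ-ℚ b))
fromℕ-ℚ-* (suc a) b = begin
  fromℕ-ℚ (b ℕ.+ a ℕ.* b)                          ≡⟨ fromℕ-ℚ-+ b (a ℕ.* b) ⟩
  fromℕ-ℚ b ℚ.+ fromℕ-ℚ (a ℕ.* b)                  ≡⟨ cong (fromℕ-ℚ b ℚ.+_) (fromℕ-ℚ-* a b) ⟩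
  fromℕ-ℚ b ℚ.+ fromℕ-ℚ a ℚ.* fromℕ-ℚ b
    ≡⟨ solve 2 (λ p q → q :+ p :* q := (con 1ℚ :+ p) :* q) refl (fromℕ-ℚ a) (fromℕ-ℚ b) ⟩
  (1ℚ ℚ.+ fromℕ-ℚ a) ℚ.* fromℕ-ℚ b                 ≡⟨ cong (ℚ._* fromℕ-ℚ b) (fromℕ-ℚ-+ 1 a) ⟨
  fromℕ-ℚ (suc a) ℚ.* fromℕ-ℚ b                    ∎
  where
  open +-*-Solver
  open ≡-Reasoning

0≤fromℕ-ℚ : ∀ k → 0ℚ ℚ.≤ fromℕ-ℚ k
0≤fromℕ-ℚ k = ℚ.nonNegative⁻¹ (fromℕ-ℚ k) {{ℚ.normalize-nonNeg k 1}}

fromℕ-ℚ-mono : ∀ {a b} → a ≤ℕ b → fromℕ-ℚ a ℚ.≤ fromℕ-ℚ b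
fromℕ-ℚ-mono {a} {b} a≤b = subst (fromℕ-ℚ a ℚ.≤_)
  (trans (sym (fromℕ-ℚ-+ (b ℕ.∸ a) a)) (cong fromℕ-ℚ (ℕ.m∸n+n≡m a≤b)))
  (p≤q+p (0≤fromℕ-ℚ (b ℕ.∸ a)))

fromℕ-ℚ-pos : ∀ k .{{_ : ℕ.NonZero k}} → 0ℚ ℚ.< fromℕ-ℚ k
fromℕ-ℚ-pos (suc k) = ℚ.<-≤-trans (ℚ.positive⁻¹ 1ℚ) (fromℕ-ℚ-mono (ℕ.s≤s (ℕ.z≤n {k})))

fromℕ-ℚ<1 : ∀ {k} → fromℕ-ℚ k ℚ.< 1ℚ → k ≡ 0
fromℕ-ℚ<1 {zero}  _  = refl
fromℕ-ℚ<1 {suc k} lt =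
  contradiction (ℚ.<-≤-trans lt (fromℕ-ℚ-mono (ℕ.s≤s (ℕ.z≤n {k})))) (ℚ.<-irrefl refl)

module _ (Δ : ℕ) (2≤Δ : 2 ≤ℕ Δ) where
  private
    instance
      Δ≢0 : ℕ.NonZero Δ
      Δ≢0 = ℕ.>-nonZero (ℕ.<-trans ℕ.z<s 2≤Δ)
      Δ-1≢0 : ℕ.NonZero (Δ ℕ.∸ 1)
      Δ-1≢0 = pred-nonZero 2≤Δ

  Δ*[1-1/Δ] : fromℕ-ℚ Δ ℚ.* 1-1/Δ Δ 2≤Δ ≡ fromℕ-ℚ (Δ ℕ.∸ 1)
  Δ*[1-1/Δ] = begin
    D ℚ.* (1ℚ ℚ.- r)                  ≡⟨ solve 2 (λ d r → d :* (con 1ℚ :- r) := d :- d :* r) refl D r ⟩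
    D ℚ.- D ℚ.* r                     ≡⟨ cong (λ u → D ℚ.- u) (*-/-cancel 1 Δ) ⟩
    D ℚ.- 1ℚ                          ≡⟨ cong (λ d → fromℕ-ℚ d ℚ.- 1ℚ) (ℕ.m+[n∸m]≡n (ℕ.<⇒≤ 2≤Δ)) ⟨
    fromℕ-ℚ (1 ℕ.+ (Δ ℕ.∸ 1)) ℚ.- 1ℚ  ≡⟨ cong (ℚ._- 1ℚ) (fromℕ-ℚ-+ 1 (Δ ℕ.∸ 1)) ⟩
    (1ℚ ℚ.+ D-1) ℚ.- 1ℚ               ≡⟨ solve 1 (λ d → (con 1ℚ :+ d) :- con 1ℚ := d) refl D-1 ⟩
    D-1                               ∎
    where
    open +-*-Solver
    open ≡-Reasoning
    D D-1 r : ℚ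
    D   = fromℕ-ℚ Δ
    D-1 = fromℕ-ℚ (Δ ℕ.∸ 1)
    r   = + 1 ℚ./ Δ

  [1-1/Δ]*Δ/[Δ-1] : 1-1/Δ Δ 2≤Δ ℚ.* Δ/[Δ-1] Δ 2≤Δ ≡ 1ℚ
  [1-1/Δ]*Δ/[Δ-1] = ℚ.≤-antisym
    (ℚ.*-cancelˡ-≤-pos D {{ℚ.positive (fromℕ-ℚ-pos Δ)}} (ℚ.≤-reflexive eq))
    (ℚ.*-cancelˡ-≤-pos D {{ℚ.positive (fromℕ-ℚ-pos Δ)}} (ℚ.≤-reflexive (sym eq)))
    where
    open ≡-Reasoning
    D : ℚ
    D = fromℕ-ℚ Δ
    eq : D ℚ.* (1-1/Δ Δ 2≤Δ ℚ.* Δ/[Δ-1] Δ 2≤Δ) ≡ D ℚ.* 1ℚ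
    eq = begin
      D ℚ.* (1-1/Δ Δ 2≤Δ ℚ.* Δ/[Δ-1] Δ 2≤Δ)   ≡⟨ ℚ.*-assoc D (1-1/Δ Δ 2≤Δ) (Δ/[Δ-1] Δ 2≤Δ) ⟨
      D ℚ.* 1-1/Δ Δ 2≤Δ ℚ.* Δ/[Δ-1] Δ 2≤Δ     ≡⟨ cong (ℚ._* Δ/[Δ-1] Δ 2≤Δ) Δ*[1-1/Δ] ⟩
      fromℕ-ℚ (Δ ℕ.∸ 1) ℚ.* Δ/[Δ-1] Δ 2≤Δ     ≡⟨ *-/-cancel Δ (Δ ℕ.∸ 1) ⟩
      D                                       ≡⟨ ℚ.*-identityʳ D ⟨
      D ℚ.* 1ℚ                                ∎

  ≤[1-1/Δ]* : ∀ {a m} → Δ ℕ.* a ≤ℕ (Δ ℕ.∸ 1) ℕ.* m → fromℕ-ℚ a ℚ.≤ 1-1/Δ Δ 2≤Δ ℚ.* fromℕ-ℚ m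
  ≤[1-1/Δ]* {a} {m} le = ℚ.*-cancelˡ-≤-pos D {{ℚ.positive (fromℕ-ℚ-pos Δ)}} (begin
    D ℚ.* fromℕ-ℚ a                          ≡⟨ fromℕ-ℚ-* Δ a ⟨
    fromℕ-ℚ (Δ ℕ.* a)                        ≤⟨ fromℕ-ℚ-mono le ⟩
    fromℕ-ℚ ((Δ ℕ.∸ 1) ℕ.* m)                ≡⟨ fromℕ-ℚ-* (Δ ℕ.∸ 1) m ⟩
    fromℕ-ℚ (Δ ℕ.∸ 1) ℚ.* fromℕ-ℚ m          ≡⟨ cong (ℚ._* fromℕ-ℚ m) Δ*[1-1/Δ] ⟨
    D ℚ.* 1-1/Δ Δ 2≤Δ ℚ.* fromℕ-ℚ m          ≡⟨ ℚ.*-assoc D (1-1/Δ Δ 2≤Δ) (fromℕ-ℚ m) ⟩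
    D ℚ.* (1-1/Δ Δ 2≤Δ ℚ.* fromℕ-ℚ m)        ∎)
    where
    open ℚR
    D : ℚ
    D = fromℕ-ℚ Δ

  -- One balanced cut lowers the logarithm to base Δ/(Δ−1) by at least one.
  shrink : ∀ {p q} k → p ℚ.≤ 1-1/Δ Δ 2≤Δ ℚ.* q → q ℚ.< Δ/[Δ-1] Δ 2≤Δ ^ℚ suc k → p ℚ.< Δ/[Δ-1] Δ 2≤Δ ^ℚ k
  shrink {p} {q} k p≤ q< = begin-strict
    p                    ≤⟨ p≤ ⟩
    c ℚ.* q              <⟨ ℚ.*-monoʳ-<-pos c {{ℚ.positive 0<c}} q< ⟩
    c ℚ.* (b ℚ.* b ^ℚ k)  ≡⟨ ℚ.*-assoc c b (b ^ℚ k) ⟨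
    c ℚ.* b ℚ.* b ^ℚ k    ≡⟨ cong (ℚ._* b ^ℚ k) [1-1/Δ]*Δ/[Δ-1] ⟩
    1ℚ ℚ.* b ^ℚ k         ≡⟨ ℚ.*-identityˡ (b ^ℚ k) ⟩
    b ^ℚ k               ∎
    where
    open ℚR
    c b : ℚ
    c = 1-1/Δ Δ 2≤Δ
    b = Δ/[Δ-1] Δ 2≤Δ
    0<c : 0ℚ ℚ.< c
    0<c = ℚ.*-cancelˡ-<-nonNeg (fromℕ-ℚ Δ) {{ℚ.nonNegative (0≤fromℕ-ℚ Δ)}}
      (subst₂ ℚ._<_ (sym (ℚ.*-zeroʳ (fromℕ-ℚ Δ))) (sym Δ*[1-1/Δ]) (fromℕ-ℚ-pos (Δ ℕ.∸ 1)))

-- Order and finite sums of reals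

infix 4 _≼_

-- A record, unlike the computing _≤_, lets Agda infer the two sides.
record _≼_ (x y : ℝ) : Set where
  constructor ≼⁺
  field ≼⁻ : x ≤ y

open _≼_ public

pointwise : ∀ {x y} → (∀ n → seq x n ℚ.≤ seq y n) → x ≼ y
pointwise {x} {y} x≤y = ≼⁺ λ e 0<e → 0 , λ n _ → begin
  seq x n            ≤⟨ x≤y n ⟩
  seq y n            ≡⟨ ℚ.+-identityʳ (seq y n) ⟨
  seq y n ℚ.+ 0ℚ     ≤⟨ ℚ.+-monoʳ-≤ (seq y n) (ℚ.<⇒≤ 0<e) ⟩
  seq y n ℚ.+ e      ∎
  where open ℚR

pointwise-≡ : ∀ {x y} → (∀ n → seq x n ≡ seq y n) → x ≼ y
pointwise-≡ x≡y = pointwise (λ n → ℚ.≤-reflexive (x≡y n))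

≼-refl : ∀ {x} → x ≼ x
≼-refl = pointwise (λ _ → ℚ.≤-refl)

≼-trans : ∀ {x y z} → x ≼ y → y ≼ z → x ≼ z
≼-trans {x} {y} {z} x≼y y≼z = ≼⁺ (≤.trans {x} {y} {z} (≼⁻ x≼y) (≼⁻ y≼z))

≃⇒≼ : ∀ {x y} → x ≃ y → x ≼ y
≃⇒≼ {x} {y} x≃y = ≼⁺ (≤.reflexive {x} {y} x≃y)

≃⇒≽ : ∀ {x y} → x ≃ y → y ≼ x
≃⇒≽ {x} {y} x≃y = ≃⇒≼ {y} {x} (IsEquivalence.sym ≃-isEquivalence {x} {y} x≃y)

module ≼-Reasoning = SingleReasoning _≼_ ≼-refl ≼-trans

+-mono-≼ : ∀ {x y u v} → x ≼ y → u ≼ v → x + u ≼ y + v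
+-mono-≼ {x} {y} {u} {v} (≼⁺ x≤y) (≼⁺ u≤v) = ≼⁺ λ e 0<e → Eventually-map₂
  (λ n p q → begin
    seq x n ℚ.+ seq u n                              ≤⟨ ℚ.+-mono-≤ p q ⟩
    (seq y n ℚ.+ ½ ℚ.* e) ℚ.+ (seq v n ℚ.+ ½ ℚ.* e)
      ≡⟨ solve 3 (λ a b c → (a :+ c) :+ (b :+ c) := (a :+ b) :+ (c :+ c)) refl (seq y n) (seq v n) (½ ℚ.* e) ⟩
    (seq y n ℚ.+ seq v n) ℚ.+ (½ ℚ.* e ℚ.+ ½ ℚ.* e)  ≡⟨ cong (seq y n ℚ.+ seq v n ℚ.+_) (half+half e) ⟩
    (seq y n ℚ.+ seq v n) ℚ.+ e                      ∎)
  (x≤y (½ ℚ.* e) (*-pos 0<½ 0<e)) (u≤v (½ ℚ.* e) (*-pos 0<½ 0<e))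
  where
  open ℚR
  open +-*-Solver

EventuallyNonNeg : ℝ → Set
EventuallyNonNeg x = Eventually λ n → 0ℚ ℚ.≤ seq x n

+-nonNegℝ : ∀ {x y} → EventuallyNonNeg x → EventuallyNonNeg y → EventuallyNonNeg (x + y)
+-nonNegℝ = Eventually-map₂ (λ _ → ℚ.+-mono-≤)

*-nonNegℝ : ∀ {x y} → EventuallyNonNeg x → EventuallyNonNeg y → EventuallyNonNeg (x * y)
*-nonNegℝ = Eventually-map₂ (λ _ → *-nonNeg)

fromℚ-nonNeg : ∀ {p} → 0ℚ ℚ.≤ p → EventuallyNonNeg (fromℚ p)
fromℚ-nonNeg 0≤p = 0 , λ _ _ → 0≤p

fromℕ-nonNeg : ∀ k → EventuallyNonNeg (fromℕ k)
fromℕ-nonNeg k = fromℚ-nonNeg (0≤fromℕ-ℚ k)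

pos⇒nonNeg : ∀ {x} → 0ℝ < x → EventuallyNonNeg x
pos⇒nonNeg (e , 0<e , N , h) = N , λ n N≤n →
  ℚ.≤-trans (ℚ.<⇒≤ 0<e) (subst (ℚ._≤ _) (ℚ.+-identityˡ e) (h n N≤n))

inverse-nonNeg : ∀ y (0<y : 0ℝ < y) → EventuallyNonNeg (inverse y 0<y)
inverse-nonNeg y (d , 0<d , _) = 0 , λ n _ →
  let d⊔yₙ = ℚ.positive (ℚ.<-≤-trans 0<d (ℚ.p≤p⊔q d (seq y n))) in
  ℚ.<⇒≤ (ℚ.positive⁻¹ _ {{ℚ.1/pos⇒pos (d ℚ.⊔ seq y n) {{d⊔yₙ}}}})

nonNeg⇒0≼ : ∀ {x} → EventuallyNonNeg x → 0ℝ ≼ x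
nonNeg⇒0≼ {x} (N , 0≤x) = ≼⁺ λ e 0<e → N , λ n N≤n →
  ℚ.+-mono-≤ (0≤x n N≤n) (ℚ.<⇒≤ 0<e)

eventuallyBounded : ∀ x → ∃[ B ] 0ℚ ℚ.< B × Eventually λ n → seq x n ℚ.≤ B
eventuallyBounded x with cauchy x 1ℚ (ℚ.positive⁻¹ 1ℚ)
... | N , h = 1ℚ ℚ.+ ∣ seq x N ∣ , ℚ.+-mono-<-≤ (ℚ.positive⁻¹ 1ℚ) (ℚ.0≤∣p∣ (seq x N)) , N , λ n N≤n → begin
    seq x n                                ≡⟨ solve 2 (λ p q → p := (p :- q) :+ q) refl (seq x n) (seq x N) ⟩
    (seq x n ℚ.- seq x N) ℚ.+ seq x N      ≤⟨ ℚ.+-mono-≤ (p≤∣p∣ (seq x n ℚ.- seq x N)) (p≤∣p∣ (seq x N)) ⟩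
    ∣ seq x n ℚ.- seq x N ∣ ℚ.+ ∣ seq x N ∣ ≤⟨ ℚ.+-monoˡ-≤ ∣ seq x N ∣ (h n N N≤n ℕ.≤-refl) ⟩
    1ℚ ℚ.+ ∣ seq x N ∣                     ∎
  where
  open ℚR
  open +-*-Solver
  p≤∣p∣ : ∀ p → p ℚ.≤ ∣ p ∣
  p≤∣p∣ p with ℚ.≤-total 0ℚ p
  ... | inj₁ 0≤p = ℚ.≤-reflexive (sym (ℚ.0≤p⇒∣p∣≡p 0≤p))
  ... | inj₂ p≤0 = ℚ.≤-trans p≤0 (ℚ.0≤∣p∣ p)

*-monoʳ-≼ : ∀ {x y} z → EventuallyNonNeg z → x ≼ y → z * x ≼ z * y
*-monoʳ-≼ {x} {y} z 0≤z (≼⁺ x≤y) = ≼⁺ λ e 0<e →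
  let B , 0<B , z≤B = eventuallyBounded z
      instance
        B-pos : ℚ.Positive B
        B-pos = ℚ.positive 0<B
        B≢0 : ℚ.NonZero B
        B≢0 = ℚ.pos⇒nonZero B
      δ = ℚ.1/ B ℚ.* e
      0<δ = *-pos (ℚ.positive⁻¹ (ℚ.1/ B) {{ℚ.1/pos⇒pos B}}) 0<e
  in Eventually-map₂
    (λ n (0≤zₙ , zₙ≤B) xₙ≤ → begin
      seq z n ℚ.* seq x n                    ≤⟨ ℚ.*-monoˡ-≤-nonNeg (seq z n) {{ℚ.nonNegative 0≤zₙ}} xₙ≤ ⟩
      seq z n ℚ.* (seq y n ℚ.+ δ)            ≡⟨ ℚ.*-distribˡ-+ (seq z n) (seq y n) δ ⟩
      seq z n ℚ.* seq y n ℚ.+ seq z n ℚ.* δ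
        ≤⟨ ℚ.+-monoʳ-≤ (seq z n ℚ.* seq y n) (ℚ.*-monoʳ-≤-nonNeg δ {{ℚ.pos⇒nonNeg δ {{ℚ.positive 0<δ}}}} zₙ≤B) ⟩
      seq z n ℚ.* seq y n ℚ.+ B ℚ.* δ
        ≡⟨ cong (seq z n ℚ.* seq y n ℚ.+_) (trans (sym (ℚ.*-assoc B (ℚ.1/ B) e)) (trans (cong (ℚ._* e) (ℚ.*-inverseʳ B)) (ℚ.*-identityˡ e))) ⟩
      seq z n ℚ.* seq y n ℚ.+ e              ∎)
    (Eventually-map₂ (λ _ → _,_) 0≤z z≤B) (x≤y δ 0<δ)
  where open ℚR

*-comm-≼ : ∀ x y → x * y ≼ y * x
*-comm-≼ x y = pointwise-≡ (λ n → ℚ.*-comm (seq x n) (seq y n))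

*-monoˡ-≼ : ∀ {x y} z → EventuallyNonNeg z → x ≼ y → x * z ≼ y * z
*-monoˡ-≼ {x} {y} z 0≤z x≼y = ≼-trans (*-comm-≼ x z) (≼-trans (*-monoʳ-≼ z 0≤z x≼y) (*-comm-≼ z y))

pos-upwards : ∀ {x y} → 0ℝ < x → x ≼ y → 0ℝ < y
pos-upwards {x} {y} (e , 0<e , 0+e≤x) (≼⁺ x≤y) =
  ½ ℚ.* e , *-pos 0<½ 0<e , Eventually-map₂
    (λ n p q → begin
      0ℚ ℚ.+ d                 ≡⟨ solve 2 (λ d o → o :+ d := (o :+ (d :+ d)) :- d) refl d 0ℚ ⟩
      (0ℚ ℚ.+ (d ℚ.+ d)) ℚ.- d ≡⟨ cong (λ u → (0ℚ ℚ.+ u) ℚ.- d) (half+half e) ⟩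
      (0ℚ ℚ.+ e) ℚ.- d         ≤⟨ ℚ.+-monoˡ-≤ (ℚ.- d) (ℚ.≤-trans p q) ⟩
      (seq y n ℚ.+ d) ℚ.- d    ≡⟨ solve 2 (λ y d → (y :+ d) :- d := y) refl (seq y n) d ⟩
      seq y n                  ∎)
    0+e≤x (x≤y d (*-pos 0<½ 0<e))
  where
  open ℚR
  open +-*-Solver
  d : ℚ
  d = ½ ℚ.* e

nonNeg-*-cancelʳ : ∀ {x y} → EventuallyNonNeg y → 0ℝ < x * y → EventuallyNonNeg x
nonNeg-*-cancelʳ {x} {y} 0≤y (e , 0<e , h) = Eventually-map₂
  (λ n 0≤yₙ p → ℚ.≮⇒≥ λ xₙ<0 → ℚ.<-irrefl {x = 0ℚ} refl (begin-strict
    0ℚ                    <⟨ 0<e ⟩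
    e                     ≡⟨ ℚ.+-identityˡ e ⟨
    0ℚ ℚ.+ e              ≤⟨ p ⟩
    seq x n ℚ.* seq y n   ≤⟨ ℚ.*-monoʳ-≤-nonNeg (seq y n) {{ℚ.nonNegative 0≤yₙ}} (ℚ.<⇒≤ xₙ<0) ⟩
    0ℚ ℚ.* seq y n        ≡⟨ ℚ.*-zeroˡ (seq y n) ⟩
    0ℚ                    ∎))
  0≤y h
  where open ℚR

*-inverseʳ-≼ : ∀ z (0<z : 0ℝ < z) → z * inverse z 0<z ≼ fromℚ 1ℚ
*-inverseʳ-≼ z 0<z = ≃⇒≼ {z * inverse z 0<z} {fromℚ 1ℚ} (*-inverseʳ z 0<z)

*-inverseʳ-≽ : ∀ z (0<z : 0ℝ < z) → fromℚ 1ℚ ≼ z * inverse z 0<z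
*-inverseʳ-≽ z 0<z = ≃⇒≽ {z * inverse z 0<z} {fromℚ 1ℚ} (*-inverseʳ z 0<z)

≼*⇒÷≼ : ∀ {x y z} → EventuallyNonNeg y → (0<z : 0ℝ < z) → x ≼ y * z → x ÷ z [ 0<z ] ≼ y
≼*⇒÷≼ {x} {y} {z} 0≤y 0<z x≼yz = begin
  x * z⁻¹          ∼⟨ *-monoˡ-≼ z⁻¹ (inverse-nonNeg z 0<z) x≼yz ⟩
  y * z * z⁻¹      ∼⟨ pointwise-≡ (λ n → ℚ.*-assoc (seq y n) (seq z n) (seq z⁻¹ n)) ⟩
  y * (z * z⁻¹)    ∼⟨ *-monoʳ-≼ y 0≤y (*-inverseʳ-≼ z 0<z) ⟩
  y * fromℚ 1ℚ     ∼⟨ pointwise-≡ (λ n → ℚ.*-identityʳ (seq y n)) ⟩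
  y                ∎
  where
  open ≼-Reasoning
  z⁻¹ : ℝ
  z⁻¹ = inverse z 0<z

÷≼⇒≼* : ∀ {x y z} → EventuallyNonNeg x → (0<z : 0ℝ < z) → x ÷ z [ 0<z ] ≼ y → x ≼ y * z
÷≼⇒≼* {x} {y} {z} 0≤x 0<z x÷z≼y = begin
  x                ∼⟨ pointwise-≡ (λ n → sym (ℚ.*-identityʳ (seq x n))) ⟩
  x * fromℚ 1ℚ     ∼⟨ *-monoʳ-≼ x 0≤x (*-inverseʳ-≽ z 0<z) ⟩
  x * (z * z⁻¹)
    ∼⟨ pointwise-≡ (λ n → solve 3 (λ a b c → a :* (b :* c) := (a :* c) :* b) refl (seq x n) (seq z n) (seq z⁻¹ n)) ⟩
  x * z⁻¹ * z      ∼⟨ *-monoˡ-≼ z (pos⇒nonNeg {z} 0<z) x÷z≼y ⟩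
  y * z            ∎
  where
  open ≼-Reasoning
  open +-*-Solver
  z⁻¹ : ℝ
  z⁻¹ = inverse z 0<z

infix 4 _≐_

_≐_ : ℝ → ℝ → Set
x ≐ y = ∀ k → seq x k ≡ seq y k

sum-mono : ∀ {n} {f g : Fin n → ℝ} → (∀ i → f i ≼ g i) → sum f ≼ sum g
sum-mono {zero}  f≼g = ≼-refl
sum-mono {suc n} f≼g = +-mono-≼ (f≼g zero) (sum-mono (f≼g ∘ suc))

sum-nonNeg : ∀ {n} {f : Fin n → ℝ} → (∀ i → EventuallyNonNeg (f i)) → EventuallyNonNeg (sum f)
sum-nonNeg {zero}      0≤f = fromℚ-nonNeg ℚ.≤-refl
sum-nonNeg {suc n} {f} 0≤f = +-nonNegℝ {f zero} {sum (f ∘ suc)} (0≤f zero) (sum-nonNeg (0≤f ∘ suc))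

sum-cong : ∀ {n} {f g : Fin n → ℝ} → (∀ i → f i ≐ g i) → sum f ≐ sum g
sum-cong {zero}  f≐g k = refl
sum-cong {suc n} f≐g k = cong₂ ℚ._+_ (f≐g zero k) (sum-cong (f≐g ∘ suc) k)

sum-+ : ∀ {n} (f g : Fin n → ℝ) → sum (λ i → f i + g i) ≐ sum f + sum g
sum-+ {zero}  f g k = refl
sum-+ {suc n} f g k = trans (cong (seq (f zero + g zero) k ℚ.+_) (sum-+ (f ∘ suc) (g ∘ suc) k))
  (solve 4 (λ a b c d → (a :+ b) :+ (c :+ d) := (a :+ c) :+ (b :+ d)) refl
    (seq (f zero) k) (seq (g zero) k) (seq (sum (f ∘ suc)) k) (seq (sum (g ∘ suc)) k))
  where open +-*-Solver

sum-* : ∀ {n} c (f : Fin n → ℝ) → sum (λ i → c * f i) ≐ c * sum f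
sum-* {zero}  c f k = sym (ℚ.*-zeroʳ (seq c k))
sum-* {suc n} c f k = trans (cong (seq (c * f zero) k ℚ.+_) (sum-* c (f ∘ suc) k))
  (sym (ℚ.*-distribˡ-+ (seq c k) (seq (f zero) k) (seq (sum (f ∘ suc)) k)))

sum-0 : ∀ n → sum {n} (λ _ → 0ℝ) ≐ 0ℝ
sum-0 zero    k = refl
sum-0 (suc n) k = trans (ℚ.+-identityˡ _) (sum-0 n k)

sum-single : ∀ {n} (f : Fin n → ℝ) j → sum (λ i → if does (i Fin.≟ j) then f i else 0ℝ) ≐ f j
sum-single {suc n} f zero    k = trans (cong (seq (f zero) k ℚ.+_) (sum-0 n k)) (ℚ.+-identityʳ _)
sum-single {suc n} f (suc j) k = trans (ℚ.+-identityˡ _) (sum-single (f ∘ suc) j k)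

sum₂-single : ∀ {n} (f : Fin n → Fin n → ℝ) a b →
  sum (λ x → sum λ y → if does (x Fin.≟ a) ∧ does (y Fin.≟ b) then f x y else 0ℝ) ≐ f a b
sum₂-single {n} f a b k = trans (sum-cong row k) (sum-single (λ x → f x b) a k)
  where
  row : ∀ x → sum (λ y → if does (x Fin.≟ a) ∧ does (y Fin.≟ b) then f x y else 0ℝ)
            ≐ (if does (x Fin.≟ a) then f x b else 0ℝ)
  row x with does (x Fin.≟ a)
  ... | true  = sum-single (f x) b
  ... | false = sum-0 n

if-mono : ∀ {c d} {x y : ℝ} → c ≡ d → (T c → x ≼ y) → (if c then x else 0ℝ) ≼ (if d then y else 0ℝ)
if-mono {true}  refl x≼y = x≼y _
if-mono {false} refl _   = ≼-refl

if-nonNeg : ∀ {c} {x : ℝ} → (T c → EventuallyNonNeg x) → EventuallyNonNeg (if c then x else 0ℝ)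
if-nonNeg {true}  0≤x = 0≤x _
if-nonNeg {false} _   = fromℚ-nonNeg ℚ.≤-refl

if-* : ∀ c d (x : ℝ) → (if d then c * x else 0ℝ) ≐ c * (if d then x else 0ℝ)
if-* c true  x k = refl
if-* c false x k = sym (ℚ.*-zeroʳ (seq c k))

if-split : ∀ {c c₁ c₂ c₃} {x : ℝ} →
  (T c → T c₁ ⊎ T c₂ ⊎ T c₃) → (T c₁ → T c) → (T c₂ → T c) → (T c₃ → T c) →
  (T c₁ → ¬ T c₂) → (T c₁ → ¬ T c₃) → (T c₂ → ¬ T c₃) →
  (if c then x else 0ℝ) ≐ (if c₁ then x else 0ℝ) + ((if c₂ then x else 0ℝ) + (if c₃ then x else 0ℝ))
if-split {c}     {true}  {true}  {c₃}    _ _ _ _ ¬₁₂ _ _ k = contradiction _ (¬₁₂ _)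
if-split {c}     {true}  {c₂}    {true}  _ _ _ _ _ ¬₁₃ _ k = contradiction _ (¬₁₃ _)
if-split {c}     {c₁}    {true}  {true}  _ _ _ _ _ _ ¬₂₃ k = contradiction _ (¬₂₃ _)
if-split {false} {true}  {false} {false} _ i _ _ _ _ _ k = contradiction (i _) λ ()
if-split {false} {false} {true}  {false} _ _ i _ _ _ _ k = contradiction (i _) λ ()
if-split {false} {false} {false} {true}  _ _ _ i _ _ _ k = contradiction (i _) λ ()
if-split {true}  {true}  {false} {false} _ _ _ _ _ _ _ k = sym (ℚ.+-identityʳ _)
if-split {true}  {false} {true}  {false} {x} _ _ _ _ _ _ _ k =
  sym (trans (ℚ.+-identityˡ _) (ℚ.+-identityʳ _))
if-split {true}  {false} {false} {true}  _ _ _ _ _ _ _ k =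
  sym (trans (ℚ.+-identityˡ _) (ℚ.+-identityˡ _))
if-split {true}  {false} {false} {false} e _ _ _ _ _ _ k with e _
... | inj₁ ()
... | inj₂ (inj₁ ())
... | inj₂ (inj₂ ())
if-split {false} {false} {false} {false} _ _ _ _ _ _ _ k = refl

module _ {n : ℕ} where

  T-<-∧⁻ : ∀ (x y : Fin n) {c} → T (does (x Fin.<? y) ∧ c) → x Fin.< y × T c
  T-<-∧⁻ x y t = let x<y , c = Equivalence.to T-∧ t in ℕ.<ᵇ⇒< (Fin.toℕ x) (Fin.toℕ y) x<y , c

  T-<-∧⁺ : ∀ (x y : Fin n) {c} → x Fin.< y → T c → T (does (x Fin.<? y) ∧ c)
  T-<-∧⁺ x y x<y c = Equivalence.from T-∧ (ℕ.<⇒<ᵇ x<y , c)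

  T-≟-∧⁻ : ∀ {x a y b : Fin n} → T (does (x Fin.≟ a) ∧ does (y Fin.≟ b)) → x ≡ a × y ≡ b
  T-≟-∧⁻ {x} {a} {y} {b} t with x Fin.≟ a | y Fin.≟ b
  ... | yes p | yes q = p , q

  T-≟-∧⁺ : ∀ {x a y b : Fin n} → x ≡ a → y ≡ b → T (does (x Fin.≟ a) ∧ does (y Fin.≟ b))
  T-≟-∧⁺ {x} {a} {y} {b} p q with x Fin.≟ a | y Fin.≟ b
  ... | yes _ | yes _ = _
  ... | yes _ | no ¬q = contradiction q ¬q
  ... | no ¬p | _     = contradiction p ¬p

  ∑-mono : ∀ {F F′ : EdgeSet n} {f g} → (∀ x y → F x y ≡ F′ x y) →
    (∀ x y → T (F x y) → f x y ≼ g x y) → ∑[xy∈ F ] f ≼ ∑[xy∈ F′ ] g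
  ∑-mono F≡F′ f≼g = sum-mono λ x → sum-mono λ y →
    if-mono (cong (does (x Fin.<? y) ∧_) (F≡F′ x y)) (f≼g x y ∘ proj₂ ∘ T-<-∧⁻ x y)

  ∑-nonNeg : ∀ {F : EdgeSet n} {f} → (∀ x y → T (F x y) → EventuallyNonNeg (f x y)) →
    EventuallyNonNeg (∑[xy∈ F ] f)
  ∑-nonNeg {F} {f} 0≤f = sum-nonNeg λ x → sum-nonNeg λ y →
    if-nonNeg {does (x Fin.<? y) ∧ F x y} {f x y} (0≤f x y ∘ proj₂ ∘ T-<-∧⁻ x y)

  ∑-* : ∀ (F : EdgeSet n) c f → ∑[xy∈ F ] (λ x y → c * f x y) ≐ c * ∑[xy∈ F ] f
  ∑-* F c f k = trans (sum-cong row k) (sum-* c (λ x → sum (term x)) k)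
    where
    term : Fin n → Fin n → ℝ
    term x y = if does (x Fin.<? y) ∧ F x y then f x y else 0ℝ
    row : ∀ x → sum (λ y → if does (x Fin.<? y) ∧ F x y then c * f x y else 0ℝ) ≐ c * sum (term x)
    row x k = trans (sum-cong (λ y → if-* c (does (x Fin.<? y) ∧ F x y) (f x y)) k)
                    (sum-* c (term x) k)

  ∑-split : ∀ {F F₁ F₂ : EdgeSet n} {a b} f → a Fin.< b → T (F a b) →
    (∀ {x y} → T (F x y) → T (F₁ x y) ⊎ T (F₂ x y) ⊎ (x ≡ a × y ≡ b) ⊎ (x ≡ b × y ≡ a)) →
    (∀ {x y} → T (F₁ x y) → T (F x y) × ¬ T (F₂ x y) × ¬ (x ≡ a × y ≡ b)) →
    (∀ {x y} → T (F₂ x y) → T (F x y) × ¬ (x ≡ a × y ≡ b)) →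
    ∑[xy∈ F ] f ≐ ∑[xy∈ F₁ ] f + (∑[xy∈ F₂ ] f + f a b)
  ∑-split {F} {F₁} {F₂} {a} {b} f a<b Fab cases left right k = begin
    seq (∑[xy∈ F ] f) k
      ≡⟨ sum-cong (λ x → sum-cong (λ y → termwise x y)) k ⟩
    seq (sum λ x → sum λ y → t₁ x y + (t₂ x y + t₃ x y)) k
      ≡⟨ sum-cong (λ x k → trans (sum-+ (t₁ x) (λ y → t₂ x y + t₃ x y) k)
           (cong (seq (sum (t₁ x)) k ℚ.+_) (sum-+ (t₂ x) (t₃ x) k))) k ⟩
    seq (sum λ x → sum (t₁ x) + (sum (t₂ x) + sum (t₃ x))) k
      ≡⟨ trans (sum-+ (sum ∘ t₁) (λ x → sum (t₂ x) + sum (t₃ x)) k)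
           (cong (seq (∑[xy∈ F₁ ] f) k ℚ.+_) (sum-+ (sum ∘ t₂) (sum ∘ t₃) k)) ⟩
    seq (∑[xy∈ F₁ ] f + (∑[xy∈ F₂ ] f + sum (sum ∘ t₃))) k
      ≡⟨ cong (λ u → seq (∑[xy∈ F₁ ] f) k ℚ.+ (seq (∑[xy∈ F₂ ] f) k ℚ.+ u)) (sum₂-single f a b k) ⟩
    seq (∑[xy∈ F₁ ] f + (∑[xy∈ F₂ ] f + f a b)) k ∎
    where
    open ≡-Reasoning
    t₁ t₂ t₃ : Fin n → Fin n → ℝ
    t₁ x y = if does (x Fin.<? y) ∧ F₁ x y then f x y else 0ℝ
    t₂ x y = if does (x Fin.<? y) ∧ F₂ x y then f x y else 0ℝ
    t₃ x y = if does (x Fin.≟ a) ∧ does (y Fin.≟ b) then f x y else 0ℝ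

    termwise : ∀ x y → (if does (x Fin.<? y) ∧ F x y then f x y else 0ℝ) ≐ t₁ x y + (t₂ x y + t₃ x y)
    termwise x y = if-split exhaustive
      (λ t → let x<y , F₁xy = T-<-∧⁻ x y t in T-<-∧⁺ x y x<y (proj₁ (left F₁xy)))
      (λ t → let x<y , F₂xy = T-<-∧⁻ x y t in T-<-∧⁺ x y x<y (proj₁ (right F₂xy)))
      (λ t → case-ab (T-≟-∧⁻ t))
      (λ t₁ t₂ → proj₁ (proj₂ (left (proj₂ (T-<-∧⁻ x y t₁)))) (proj₂ (T-<-∧⁻ x y t₂)))
      (λ t₁ t₃ → proj₂ (proj₂ (left (proj₂ (T-<-∧⁻ x y t₁)))) (T-≟-∧⁻ t₃))
      (λ t₂ t₃ → proj₂ (right (proj₂ (T-<-∧⁻ x y t₂))) (T-≟-∧⁻ t₃))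
      where
      case-ab : x ≡ a × y ≡ b → T (does (x Fin.<? y) ∧ F x y)
      case-ab (refl , refl) = T-<-∧⁺ a b a<b Fab
      exhaustive : T (does (x Fin.<? y) ∧ F x y) →
        T (does (x Fin.<? y) ∧ F₁ x y) ⊎ T (does (x Fin.<? y) ∧ F₂ x y) ⊎
        T (does (x Fin.≟ a) ∧ does (y Fin.≟ b))
      exhaustive t with T-<-∧⁻ x y t
      ... | x<y , Fxy with cases Fxy
      ...   | inj₁ F₁xy = inj₁ (T-<-∧⁺ x y x<y F₁xy)
      ...   | inj₂ (inj₁ F₂xy) = inj₂ (inj₁ (T-<-∧⁺ x y x<y F₂xy))
      ...   | inj₂ (inj₂ (inj₁ (p , q))) = inj₂ (inj₂ (T-≟-∧⁺ p q))
      ...   | inj₂ (inj₂ (inj₂ (refl , refl))) = contradiction x<y (ℕ.<-asym a<b)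

-- Walks and components

∣p∪q∣≤∣p∣+∣q∣ : ∀ {n} (p q : Subset n) → Subset.∣ p ∪ q ∣ ≤ℕ Subset.∣ p ∣ ℕ.+ Subset.∣ q ∣
∣p∪q∣≤∣p∣+∣q∣ []            []            = ℕ.z≤n
∣p∪q∣≤∣p∣+∣q∣ (outside ∷ p) (outside ∷ q) = ∣p∪q∣≤∣p∣+∣q∣ p q
∣p∪q∣≤∣p∣+∣q∣ (outside ∷ p) (inside  ∷ q) =
  subst (suc Subset.∣ p ∪ q ∣ ≤ℕ_) (sym (ℕ.+-suc _ _)) (ℕ.s≤s (∣p∪q∣≤∣p∣+∣q∣ p q))
∣p∪q∣≤∣p∣+∣q∣ (inside  ∷ p) (outside ∷ q) = ℕ.s≤s (∣p∪q∣≤∣p∣+∣q∣ p q)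
∣p∪q∣≤∣p∣+∣q∣ (inside  ∷ p) (inside  ∷ q) =
  ℕ.s≤s (ℕ.≤-trans (∣p∪q∣≤∣p∣+∣q∣ p q) (ℕ.+-monoʳ-≤ Subset.∣ p ∣ (ℕ.n≤1+n _)))

disjoint⇒∣p∪q∣≡∣p∣+∣q∣ : ∀ {n} (p q : Subset n) → (∀ {x} → x ∈ p → x ∉ q) →
  Subset.∣ p ∪ q ∣ ≡ Subset.∣ p ∣ ℕ.+ Subset.∣ q ∣
disjoint⇒∣p∪q∣≡∣p∣+∣q∣ []            []            _ = refl
disjoint⇒∣p∪q∣≡∣p∣+∣q∣ (outside ∷ p) (outside ∷ q) d =
  disjoint⇒∣p∪q∣≡∣p∣+∣q∣ p q λ x∈p x∈q → d (Vec.there x∈p) (Vec.there x∈q)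
disjoint⇒∣p∪q∣≡∣p∣+∣q∣ (outside ∷ p) (inside  ∷ q) d = trans
  (cong suc (disjoint⇒∣p∪q∣≡∣p∣+∣q∣ p q λ x∈p x∈q → d (Vec.there x∈p) (Vec.there x∈q)))
  (sym (ℕ.+-suc _ _))
disjoint⇒∣p∪q∣≡∣p∣+∣q∣ (inside  ∷ p) (outside ∷ q) d =
  cong suc (disjoint⇒∣p∪q∣≡∣p∣+∣q∣ p q λ x∈p x∈q → d (Vec.there x∈p) (Vec.there x∈q))
disjoint⇒∣p∪q∣≡∣p∣+∣q∣ (inside  ∷ p) (inside  ∷ q) d = contradiction Vec.here (d Vec.here)

T-not⁻ : ∀ {b} → T (not b) → ¬ T b
T-not⁻ {false} _ ()

T-not⁺ : ∀ {b} → ¬ T b → T (not b)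
T-not⁺ {false} _  = _
T-not⁺ {true}  ¬t = ¬t _

module _ {n : ℕ} where

  private
    variable
      F : EdgeSet n
      S : Subset n
      x y z : Fin n

  unique⇒length≤∣p∣ : ∀ {xs} {p : Subset n} → Unique xs → All (_∈ p) xs → List.length xs ≤ℕ Subset.∣ p ∣
  unique⇒length≤∣p∣ []           []             = ℕ.z≤n
  unique⇒length≤∣p∣ {p = p} (x∉xs ∷ xs!) (x∈p ∷ xs⊆p) = ℕ.≤-trans
    (ℕ.s≤s (unique⇒length≤∣p∣ xs! (All.zipWith (λ (x≢y , y∈p) → Subset.x∈p∧x≢y⇒x∈p-y y∈p (x≢y ∘ sym)) (x∉xs , xs⊆p))))
    (Subset.x∈p⇒∣p-x∣<∣p∣ x∈p)

  ∣p∣≤1⇒≡ : ∀ {p : Subset n} → Subset.∣ p ∣ ≤ℕ 1 → x ∈ p → y ∈ p → x ≡ y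
  ∣p∣≤1⇒≡ {x = x} {y = y} ∣p∣≤1 x∈p y∈p with x Fin.≟ y
  ... | yes x≡y = x≡y
  ... | no  x≢y = contradiction
    (ℕ.≤-trans (unique⇒length≤∣p∣ ((x≢y ∷ []) ∷ [] ∷ []) (x∈p ∷ y∈p ∷ [])) ∣p∣≤1) λ { (ℕ.s≤s ()) }

  ∣p∣≥1⇒nonempty : ∀ {p : Subset n} → 1 ≤ℕ Subset.∣ p ∣ → ∃[ x ] x ∈ p
  ∣p∣≥1⇒nonempty {p} 1≤∣p∣ with Subset.nonempty? p
  ... | yes ne = ne
  ... | no ¬ne = contradiction (subst (1 ≤ℕ_) (trans (cong Subset.∣_∣ (Subset.Empty-unique ¬ne)) (Subset.∣⊥∣≡0 n)) 1≤∣p∣) λ ()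

  ∈⇒T : x ∈ S → T (Vec.lookup S x)
  ∈⇒T {x = x} {S = S} x∈S = subst T (sym (Vec.[]=⇒lookup x∈S)) _

  T⇒∈ : T (Vec.lookup S x) → x ∈ S
  T⇒∈ {S = S} {x = x} t with Vec.lookup S x in eq
  ... | true = Vec.lookup⇒[]= x S eq

  induced⁺ : T (F x y) → x ∈ S → y ∈ S → T (induced F S x y)
  induced⁺ xy x∈S y∈S = Equivalence.from T-∧ (xy , Equivalence.from T-∧ (∈⇒T x∈S , ∈⇒T y∈S))

  induced⁻ : ∀ (F : EdgeSet n) S {x y} → T (induced F S x y) → T (F x y) × x ∈ S × y ∈ S
  induced⁻ _ _ t =
    let xy , t′ = Equivalence.to T-∧ t
        x∈S , y∈S = Equivalence.to T-∧ t′
    in xy , T⇒∈ x∈S , T⇒∈ y∈S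

  removeEdge⁺ : ∀ {a b} → T (F x y) → ¬ (x ≡ a × y ≡ b) → ¬ (x ≡ b × y ≡ a) → T (removeEdge F a b x y)
  removeEdge⁺ xy ¬ab ¬ba = Equivalence.from T-∧
    (xy , T-not⁺ λ t → [ ¬ab ∘ T-≟-∧⁻ , ¬ba ∘ T-≟-∧⁻ ]′ (Equivalence.to T-∨ t))

  removeEdge⁻ : ∀ {a b} → T (removeEdge F a b x y) → T (F x y) × ¬ (x ≡ a × y ≡ b) × ¬ (x ≡ b × y ≡ a)
  removeEdge⁻ t = let xy , ¬t = Equivalence.to T-∧ t in
    xy , (λ (p , q) → T-not⁻ ¬t (Equivalence.from T-∨ (inj₁ (T-≟-∧⁺ p q))))
       , (λ (p , q) → T-not⁻ ¬t (Equivalence.from T-∨ (inj₂ (T-≟-∧⁺ p q))))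

  walk-preserves : (P : Fin n → Set) → (∀ {a b} → T (F a b) → P a → P b) → Walk F x y → P x → P y
  walk-preserves P step ε       px = px
  walk-preserves P step (e ◅ p) px = walk-preserves P step p (step e px)

  snoc : Walk F x y → T (F y z) → Walk F x z
  snoc p e = p ◅◅ e ◅ ε

  length-map : ∀ {F F′ : EdgeSet n} (F⊆F′ : ∀ {a b} → T (F a b) → T (F′ a b)) (p : Walk F x y) →
    length {E = F′} (Star.map F⊆F′ p) ≡ length {E = F} p
  length-map F⊆F′ ε       = refl
  length-map F⊆F′ (e ◅ p) = cong suc (length-map F⊆F′ p)

  vertices-map : ∀ {F F′ : EdgeSet n} (F⊆F′ : ∀ {a b} → T (F a b) → T (F′ a b)) (p : Walk F x y) →
    vertices {E = F′} (Star.map F⊆F′ p) ≡ vertices {E = F} p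
  vertices-map F⊆F′ ε       = refl
  vertices-map F⊆F′ (e ◅ p) = cong (_ ∷_) (vertices-map F⊆F′ p)

  length-vertices : ∀ {F : EdgeSet n} (p : Walk F x y) → List.length (vertices {E = F} p) ≡ suc (length {E = F} p)
  length-vertices ε       = refl
  length-vertices (e ◅ p) = cong suc (length-vertices p)

  SimpleWalk : EdgeSet n → Fin n → Fin n → Set
  SimpleWalk F x y = Σ[ p ∈ Walk F x y ] Unique (vertices {E = F} p)

  suffix : ∀ {F : EdgeSet n} (p : Walk F y z) → Unique (vertices {E = F} p) →
    x ∈ᴸ vertices {E = F} p → SimpleWalk F x z
  suffix ε       p!       (here refl) = ε , p!
  suffix (e ◅ p) p!       (here refl) = e ◅ p , p!
  suffix (e ◅ p) (_ ∷ p!) (there x∈p) = suffix p p! x∈p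

  loopErase : ∀ {F : EdgeSet n} → Walk F x y → SimpleWalk F x y
  loopErase ε = ε , [] ∷ []
  loopErase {x = x} {F = F} (e ◅ p) with loopErase {F = F} p
  ... | q , q! with DecMembership._∈?_ Fin._≟_ x (vertices {E = F} q)
  ...   | yes x∈q = suffix q q! x∈q
  ...   | no  x∉q = e ◅ q , All.¬Any⇒All¬ _ x∉q ∷ q!

  simple⇒length<n : ∀ {F : EdgeSet n} ((p , _) : SimpleWalk F x y) → length {E = F} p ℕ.< n
  simple⇒length<n {F = F} (p , p!) = subst₂ _≤ℕ_ (length-vertices p) (Subset.∣⊤∣≡n n)
    (unique⇒length≤∣p∣ p! (All.universal (λ _ → Subset.∈⊤) (vertices {E = F} p)))

  induced-vertices : ∀ {F : EdgeSet n} (p : Walk (induced F S) x y) → x ∈ S → All (_∈ S) (vertices {E = induced F S} p)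
  induced-vertices         ε       x∈S = x∈S ∷ []
  induced-vertices {F = F} (e ◅ p) x∈S = x∈S ∷ induced-vertices {F = F} p (proj₂ (proj₂ (induced⁻ F _ e)))

  shortWalk : ∀ {F : EdgeSet n} → Walk (induced F S) x y → x ∈ S →
    Σ[ p ∈ Walk F x y ] length {E = F} p ≤ℕ Subset.∣ S ∣ ℕ.∸ 1
  shortWalk {S = S} {F = F} p x∈S =
    let q , q! = loopErase {F = induced F S} p
        F[S]⊆F = λ {a} {b} e → proj₁ (induced⁻ F S {a} {b} e) in
    Star.map F[S]⊆F q ,
    subst (_≤ℕ _) (sym (length-map F[S]⊆F q))
      (ℕ.∸-monoˡ-≤ 1 (subst (_≤ℕ _) (length-vertices q) (unique⇒length≤∣p∣ q! (induced-vertices {F = F} q x∈S))))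

  module _ (F : EdgeSet n) where

    walk≤? : ∀ k x y → Dec (Σ[ p ∈ Walk F x y ] length {E = F} p ≤ℕ k)
    walk≤? k       x y with x Fin.≟ y
    walk≤? k       x y | yes refl = yes (ε , ℕ.z≤n)
    walk≤? zero    x y | no  x≢y  = no λ { (ε , _) → x≢y refl }
    walk≤? (suc k) x y | no  x≢y  = Dec.map′
      (λ (z , e , p , le) → e ◅ p , ℕ.s≤s le)
      (λ { (ε , _) → contradiction refl x≢y ; (e ◅ p , ℕ.s≤s le) → _ , e , p , le })
      (Fin.any? λ z → T? (F x z) ×-dec walk≤? k z y)

    walk? : ∀ x y → Dec (Walk F x y)
    walk? x y = Dec.map′ proj₁
      (λ p → let q = loopErase {F = F} p in proj₁ q , ℕ.<⇒≤ (simple⇒length<n {F = F} q))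
      (walk≤? n x y)

    component : Fin n → Subset n
    component x = Vec.tabulate λ y → Dec.⌊ walk? x y ⌋

    component-isComponent : ∀ x → IsComponentOf F x (component x)
    component-isComponent x y = mk⇔
      (λ y∈ → Dec.toWitness {a? = walk? x y} (subst T (Vec.lookup∘tabulate _ y) (∈⇒T y∈)))
      (λ p → T⇒∈ (subst T (sym (Vec.lookup∘tabulate _ y)) (Dec.fromWitness {a? = walk? x y} p)))

-- Splitting a tree at an edge

module _ {n : ℕ} where

  private
    variable
      x y z : Fin n

  no-detour : ∀ {E F : EdgeSet n} → Acyclic E → (∀ {a b} → T (F a b) → T (E a b)) →
    x ≢ y → T (E x y) → ¬ T (F y x) → ¬ Walk F y x
  no-detour {E = E} {F} acyclic F⊆E x≢y xy ¬yx p with loopErase {F = F} p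
  ... | ε , _         = x≢y refl
  ... | e ◅ ε , _     = ¬yx e
  ... | q@(_ ◅ _ ◅ _) , q! = acyclic xy (Star.map F⊆E q)
    (subst Unique (sym (vertices-map {F = F} {E} F⊆E q)) q!) (ℕ.s≤s (ℕ.s≤s ℕ.z≤n))

module _ {n : ℕ} (G : WeightedGraph n) where
  open WeightedGraph G

  private
    variable
      S A B : Subset n
      x y z : Fin n

  edge-sym : T (E x y) → T (E y x)
  edge-sym {x} {y} = subst T (E-sym x y)

  edge⇒≢ : T (E x y) → x ≢ y
  edge⇒≢ {x} xx refl = subst T (E-irr x) xx

  induced-sym : T (induced E S x y) → T (induced E S y x)
  induced-sym {S} xy = let e , x∈S , y∈S = induced⁻ E S xy in induced⁺ {F = E} (edge-sym e) y∈S x∈S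

  reverse : (F : EdgeSet n) → (∀ {a b} → T (F a b) → T (F b a)) → Walk F x y → Walk F y x
  reverse F F-sym = Star.reverse F-sym

  removeEdge-sym : ∀ {S} a b {x y} → T (removeEdge (induced E S) a b x y) → T (removeEdge (induced E S) a b y x)
  removeEdge-sym {S} a b t =
    let e , ¬ab , ¬ba = removeEdge⁻ {F = induced E S} {a = a} {b} t in
    removeEdge⁺ {F = induced E S} (induced-sym {S = S} e) (λ (p , q) → ¬ba (q , p)) (λ (p , q) → ¬ab (q , p))

  record Split (S A B : Subset n) (x y : Fin n) : Set where
    field
      edge     : T (E x y)
      x∈A      : x ∈ A
      y∈B      : y ∈ B
      A⊆S      : ∀ {z} → z ∈ A → z ∈ S
      B⊆S      : ∀ {z} → z ∈ B → z ∈ S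
      cover    : ∀ {z} → z ∈ S → z ∈ A ⊎ z ∈ B
      disjoint : ∀ {z} → z ∈ A → z ∉ B
      connᴬ    : ConnectedOn E A
      connᴮ    : ConnectedOn E B
      crossing : ∀ {p q} → p ∈ A → q ∈ B → T (E p q) → p ≡ x × q ≡ y

    ∣S∣≡∣A∣+∣B∣ : Subset.∣ S ∣ ≡ Subset.∣ A ∣ ℕ.+ Subset.∣ B ∣
    ∣S∣≡∣A∣+∣B∣ = trans
      (cong Subset.∣_∣ (Subset.⊆-antisym (Subset.x∈p∪q⁺ ∘ cover) ([ A⊆S , B⊆S ]′ ∘ Subset.x∈p∪q⁻ A B)))
      (disjoint⇒∣p∪q∣≡∣p∣+∣q∣ A B disjoint)

    1≤∣A∣ : 1 ≤ℕ Subset.∣ A ∣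
    1≤∣A∣ = unique⇒length≤∣p∣ ([] ∷ []) (x∈A ∷ [])

    1≤∣B∣ : 1 ≤ℕ Subset.∣ B ∣
    1≤∣B∣ = unique⇒length≤∣p∣ ([] ∷ []) (y∈B ∷ [])

  Split-sym : Split S A B x y → Split S B A y x
  Split-sym s = record
    { edge     = edge-sym edge
    ; x∈A      = y∈B
    ; y∈B      = x∈A
    ; A⊆S      = B⊆S
    ; B⊆S      = A⊆S
    ; cover    = swap ∘ cover
    ; disjoint = λ z∈B z∈A → disjoint z∈A z∈B
    ; connᴬ    = connᴮ
    ; connᴮ    = connᴬ
    ; crossing = λ p∈B q∈A pq → let q≡x , p≡y = crossing q∈A p∈B (edge-sym pq) in p≡y , q≡x
    }
    where open Split s

  module _ (acyclic : Acyclic E) (conn : ConnectedOn E S) (xy : T (induced E S x y)) where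
    private
      R : EdgeSet n
      R = removeEdge (induced E S) x y

      R⁻ : ∀ {a b} → T (R a b) → T (induced E S a b) × ¬ (a ≡ x × b ≡ y) × ¬ (a ≡ y × b ≡ x)
      R⁻ {a} {b} = removeEdge⁻ {F = induced E S} {x = a} {b}

      Exy : T (E x y)
      Exy = proj₁ (induced⁻ E S xy)

      x∈S : x ∈ S
      x∈S = proj₁ (proj₂ (induced⁻ E S xy))

      y∈S : y ∈ S
      y∈S = proj₂ (proj₂ (induced⁻ E S xy))

      R-rev : ∀ {a b} → Walk R a b → Walk R b a
      R-rev = reverse R (λ {a} {b} → removeEdge-sym {S} x y {a} {b})

      ¬y⇝x : ¬ Walk R y x
      ¬y⇝x = no-detour {F = R} acyclic (λ {a} {b} e → proj₁ (induced⁻ E S {a} {b} (proj₁ (R⁻ {a} {b} e))))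
        (edge⇒≢ Exy) Exy (λ e → proj₂ (proj₂ (R⁻ {y} {x} e)) (refl , refl))

      walk⇒∈S : ∀ {a b} → Walk R a b → a ∈ S → b ∈ S
      walk⇒∈S = walk-preserves {F = R} (_∈ S) λ {a} {b} e _ → proj₂ (proj₂ (induced⁻ E S (proj₁ (R⁻ {a} {b} e))))

      component-connected : ∀ {v C} → IsComponentOf R v C → ConnectedOn E C
      component-connected {v} {C} C-comp p∈C q∈C = reverse (induced E C) (induced-sym {S = C}) (from-v p∈C) ◅◅ from-v q∈C
        where
        from-v : ∀ {p} → p ∈ C → Walk (induced E C) v p
        from-v {p} p∈C = proj₂ (walk-preserves {F = R} (λ z → Walk R v z × Walk (induced E C) v z)
          (λ {a} {b} e (r , i) → let r′ = snoc {F = R} r e in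
            r′ , snoc {F = induced E C} i (induced⁺ {F = E} (proj₁ (induced⁻ E S (proj₁ (R⁻ {a} {b} e))))
              (Equivalence.from (C-comp a) r) (Equivalence.from (C-comp b) r′)))
          (Equivalence.to (C-comp p) p∈C) (ε , ε))

    components-split : IsComponentOf R x A → IsComponentOf R y B → Split S A B x y
    components-split {A} {B} A-comp B-comp = record
      { edge     = Exy
      ; x∈A      = A⁺ ε
      ; y∈B      = B⁺ ε
      ; A⊆S      = λ z∈A → walk⇒∈S (A⁻ z∈A) x∈S
      ; B⊆S      = λ z∈B → walk⇒∈S (B⁻ z∈B) y∈S
      ; cover    = λ z∈S → walk-preserves {F = induced E S} (λ z → z ∈ A ⊎ z ∈ B) step (conn x∈S z∈S) (inj₁ (A⁺ ε))
      ; disjoint = disjoint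
      ; connᴬ    = component-connected A-comp
      ; connᴮ    = component-connected B-comp
      ; crossing = crossing
      }
      where
      A⁺ : ∀ {z} → Walk R x z → z ∈ A
      A⁺ {z} = Equivalence.from (A-comp z)
      A⁻ : ∀ {z} → z ∈ A → Walk R x z
      A⁻ {z} = Equivalence.to (A-comp z)
      B⁺ : ∀ {z} → Walk R y z → z ∈ B
      B⁺ {z} = Equivalence.from (B-comp z)
      B⁻ : ∀ {z} → z ∈ B → Walk R y z
      B⁻ {z} = Equivalence.to (B-comp z)

      disjoint : ∀ {z} → z ∈ A → z ∉ B
      disjoint z∈A z∈B = ¬y⇝x (B⁻ z∈B ◅◅ R-rev (A⁻ z∈A))

      step : ∀ {a b} → T (induced E S a b) → a ∈ A ⊎ a ∈ B → b ∈ A ⊎ b ∈ B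
      step {a} {b} ab a∈ with (a Fin.≟ x) ×-dec (b Fin.≟ y) | (a Fin.≟ y) ×-dec (b Fin.≟ x)
      ... | yes (_ , refl) | _              = inj₂ (B⁺ ε)
      ... | no _           | yes (_ , refl) = inj₁ (A⁺ ε)
      ... | no ¬xy         | no ¬yx         with a∈
      ...   | inj₁ a∈A = inj₁ (A⁺ (snoc {F = R} (A⁻ a∈A) (removeEdge⁺ {F = induced E S} ab ¬xy ¬yx)))
      ...   | inj₂ a∈B = inj₂ (B⁺ (snoc {F = R} (B⁻ a∈B) (removeEdge⁺ {F = induced E S} ab ¬xy ¬yx)))

      crossing : ∀ {p q} → p ∈ A → q ∈ B → T (E p q) → p ≡ x × q ≡ y
      crossing {p} {q} p∈A q∈B pq with (p Fin.≟ x) ×-dec (q Fin.≟ y)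
      ... | yes eqs = eqs
      ... | no ¬xy  = contradiction q∈B (disjoint (A⁺ (snoc {F = R} (A⁻ p∈A)
        (removeEdge⁺ {F = induced E S}
          (induced⁺ {F = E} pq (walk⇒∈S (A⁻ p∈A) x∈S) (walk⇒∈S (B⁻ q∈B) y∈S))
          ¬xy λ { (refl , _) → disjoint p∈A (B⁺ ε) }))))

  private
    oriented-∑-split : Split S A B x y → x Fin.< y → ∀ f →
      ∑[xy∈ induced E S ] f ≐ ∑[xy∈ induced E A ] f + (∑[xy∈ induced E B ] f + f x y)
    oriented-∑-split {S} {A} {B} {x} {y} s x<y f =
      ∑-split f x<y (induced⁺ {F = E} edge (A⊆S x∈A) (B⊆S y∈B)) cases left right
      where
      open Split s
      cases : ∀ {p q} → T (induced E S p q) →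
        T (induced E A p q) ⊎ T (induced E B p q) ⊎ (p ≡ x × q ≡ y) ⊎ (p ≡ y × q ≡ x)
      cases {p} {q} t with induced⁻ E S {p} {q} t
      ... | pq , p∈S , q∈S with cover p∈S | cover q∈S
      ...   | inj₁ p∈A | inj₁ q∈A = inj₁ (induced⁺ {F = E} pq p∈A q∈A)
      ...   | inj₂ p∈B | inj₂ q∈B = inj₂ (inj₁ (induced⁺ {F = E} pq p∈B q∈B))
      ...   | inj₁ p∈A | inj₂ q∈B = inj₂ (inj₂ (inj₁ (crossing p∈A q∈B pq)))
      ...   | inj₂ p∈B | inj₁ q∈A =
        let q≡x , p≡y = crossing q∈A p∈B (edge-sym pq) in inj₂ (inj₂ (inj₂ (p≡y , q≡x)))
      left : ∀ {p q} → T (induced E A p q) → T (induced E S p q) × ¬ T (induced E B p q) × ¬ (p ≡ x × q ≡ y)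
      left {p} {q} t = let pq , p∈A , q∈A = induced⁻ E A {p} {q} t in
        induced⁺ {F = E} pq (A⊆S p∈A) (A⊆S q∈A) ,
        (λ t′ → disjoint p∈A (proj₁ (proj₂ (induced⁻ E B {p} {q} t′)))) ,
        (λ { (_ , refl) → disjoint q∈A y∈B })
      right : ∀ {p q} → T (induced E B p q) → T (induced E S p q) × ¬ (p ≡ x × q ≡ y)
      right {p} {q} t = let pq , p∈B , q∈B = induced⁻ E B {p} {q} t in
        induced⁺ {F = E} pq (B⊆S p∈B) (B⊆S q∈B) , (λ { (refl , _) → disjoint x∈A p∈B })

  -- Sums count the edge xy in its increasing orientation ab.
  Split-∑ : Split S A B x y → ∀ f → ∃[ a ] ∃[ b ] ((a ≡ x × b ≡ y) ⊎ (a ≡ y × b ≡ x)) ×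
    ∑[xy∈ induced E S ] f ≐ ∑[xy∈ induced E A ] f + (∑[xy∈ induced E B ] f + f a b)
  Split-∑ {S} {A} {B} {x} {y} s f with Fin.<-cmp x y
  ... | tri< x<y _ _  = x , y , inj₁ (refl , refl) , oriented-∑-split s x<y f
  ... | tri≈ _ x≡y _  = contradiction x≡y (edge⇒≢ (Split.edge s))
  ... | tri> _ _ y<x  = y , x , inj₂ (refl , refl) , λ k →
    trans (oriented-∑-split (Split-sym s) y<x f k)
      (solve 3 (λ p q r → p :+ (q :+ r) := q :+ (p :+ r)) refl
        (seq (∑[xy∈ induced E B ] f) k) (seq (∑[xy∈ induced E A ] f) k) (seq (f y x) k))
    where open +-*-Solver

-- Hierarchies

module _ {n : ℕ} where
  open DecMembership (Fin._≟_ {n}) using () renaming (_∈?_ to _∈ᴸ?_)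

  private
    variable
      S A B : Subset n
      x y z : Fin n
      t l r : Tree ⊤ (Fin n)

  toList-node : ∀ (l : Tree ⊤ (Fin n)) r → Leaves.toList (node l tt r) ≡ Leaves.toList l List.++ Leaves.toList r
  toList-node l r = toDiffList-++ l (Leaves.toList r)
    where
    toDiffList-++ : ∀ (t : Tree ⊤ (Fin n)) xs → Leaves.toDiffList t xs ≡ Leaves.toList t List.++ xs
    toDiffList-++ (leaf v)     xs = refl
    toDiffList-++ (node l _ r) xs = begin
      Leaves.toDiffList l (Leaves.toDiffList r xs)                        ≡⟨ toDiffList-++ l (Leaves.toDiffList r xs) ⟩
      Leaves.toList l List.++ Leaves.toDiffList r xs
        ≡⟨ cong (Leaves.toList l List.++_) (toDiffList-++ r xs) ⟩
      Leaves.toList l List.++ Leaves.toList r List.++ xs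
        ≡⟨ List.++-assoc (Leaves.toList l) (Leaves.toList r) xs ⟨
      (Leaves.toList l List.++ Leaves.toList r) List.++ xs
        ≡⟨ cong (List._++ xs) (toDiffList-++ l (Leaves.toList r)) ⟨
      Leaves.toDiffList l (Leaves.toDiffList r []) List.++ xs             ∎
      where open ≡-Reasoning

  -- The height h of the paper, for a tree with leaves in a part of the vertex set.
  height : Tree ⊤ (Fin n) → Fin n → Fin n → ℕ
  height t x y = if does (x Fin.≟ y) then 0 else List.length (Leaves.toList (lca t x y)) ℕ.∸ 1

  height-cong : ∀ t t′ x y → lca t x y ≡ lca t′ x y → height t x y ≡ height t′ x y
  height-cong _ _ x y = cong λ u → if does (x Fin.≟ y) then 0 else List.length (Leaves.toList u) ℕ.∸ 1

  height-leaf : ∀ v → height (leaf v) x y ≡ 0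
  height-leaf {x} {y} v with does (x Fin.≟ y)
  ... | true  = refl
  ... | false = refl

  both⁺ : x ∈ᴸ Leaves.toList t → y ∈ᴸ Leaves.toList t → both x y t ≡ true
  both⁺ {x} {t} {y} x∈ y∈ = cong₂ _∧_ (Dec.dec-true (x ∈ᴸ? Leaves.toList t) x∈) (Dec.dec-true (y ∈ᴸ? Leaves.toList t) y∈)

  both⁻ˡ : ¬ x ∈ᴸ Leaves.toList t → both x y t ≡ false
  both⁻ˡ {x} {t} {y} x∉ = cong (_∧ does (y ∈ᴸ? Leaves.toList t)) (Dec.dec-false (x ∈ᴸ? Leaves.toList t) x∉)

  both⁻ʳ : ¬ y ∈ᴸ Leaves.toList t → both x y t ≡ false
  both⁻ʳ {y} {t} {x} y∉ with does (x ∈ᴸ? Leaves.toList t)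
  ... | true  = Dec.dec-false (y ∈ᴸ? Leaves.toList t) y∉
  ... | false = refl

  record Spans (t : Tree ⊤ (Fin n)) (S : Subset n) : Set where
    field
      unique : Unique (Leaves.toList t)
      sound  : ∀ {z} → z ∈ᴸ Leaves.toList t → z ∈ S
      complete : ∀ {z} → z ∈ S → z ∈ᴸ Leaves.toList t
      size   : List.length (Leaves.toList t) ≡ Subset.∣ S ∣

  open Spans

  leaf-spans : ∀ v → v ∈ S → Subset.∣ S ∣ ≡ 1 → Spans (leaf v) S
  leaf-spans v v∈S ∣S∣≡1 = record
    { unique   = [] ∷ []
    ; sound    = λ { (here refl) → v∈S }
    ; complete = λ z∈S → here (∣p∣≤1⇒≡ (ℕ.≤-reflexive ∣S∣≡1) z∈S v∈S)
    ; size     = sym ∣S∣≡1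
    }

  module _ (L : Spans l A) (R : Spans r B) (disjoint : ∀ {z} → z ∈ A → z ∉ B) where

    node-spans : (∀ {z} → z ∈ A → z ∈ S) → (∀ {z} → z ∈ B → z ∈ S) → (∀ {z} → z ∈ S → z ∈ A ⊎ z ∈ B) →
      Subset.∣ S ∣ ≡ Subset.∣ A ∣ ℕ.+ Subset.∣ B ∣ → Spans (node l tt r) S
    node-spans A⊆S B⊆S cover ∣S∣≡ = record
      { unique   = subst Unique (sym (toList-node l r))
          (Unique.++⁺ (unique L) (unique R) λ (z∈l , z∈r) → disjoint (sound L z∈l) (sound R z∈r))
      ; sound    = λ z∈ → [ A⊆S ∘ sound L , B⊆S ∘ sound R ]′
          (∈-++⁻ (Leaves.toList l) (subst (_ ∈ᴸ_) (toList-node l r) z∈))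
      ; complete = λ z∈S → subst (_ ∈ᴸ_) (sym (toList-node l r))
          ([ ∈-++⁺ˡ ∘ complete L , ∈-++⁺ʳ (Leaves.toList l) ∘ complete R ]′ (cover z∈S))
      ; size     = trans (cong List.length (toList-node l r)) (trans (List.length-++ (Leaves.toList l))
          (trans (cong₂ ℕ._+_ (size L) (size R)) (sym ∣S∣≡)))
      }

    height-left : x ∈ A → y ∈ A → height (node l tt r) x y ≡ height l x y
    height-left {x} {y} x∈A y∈A = height-cong (node l tt r) l x y lca≡
      where
      lca≡ : lca (node l tt r) x y ≡ lca l x y
      lca≡ rewrite both⁺ {t = l} (complete L x∈A) (complete L y∈A) = refl

    height-right : x ∈ B → y ∈ B → height (node l tt r) x y ≡ height r x y
    height-right {x} {y} x∈B y∈B = height-cong (node l tt r) r x y lca≡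
      where
      lca≡ : lca (node l tt r) x y ≡ lca r x y
      lca≡ rewrite both⁻ˡ {t = l} {y = y} (λ x∈l → disjoint (sound L x∈l) x∈B)
                 | both⁺ {t = r} (complete R x∈B) (complete R y∈B) = refl

    height-across : Spans (node l tt r) S → x ∈ A → y ∈ B → height (node l tt r) x y ≡ Subset.∣ S ∣ ℕ.∸ 1
    height-across {x = x} {y} N x∈A y∈B
      rewrite Dec.dec-false (x Fin.≟ y) (λ { refl → disjoint x∈A y∈B })
            | both⁻ʳ {t = l} {x = x} (λ y∈l → disjoint (sound L y∈l) y∈B)
            | both⁻ˡ {t = r} {y = y} (λ x∈r → disjoint x∈A (sound R x∈r)) = cong (ℕ._∸ 1) (size N)

    height-across′ : Spans (node l tt r) S → x ∈ B → y ∈ A → height (node l tt r) x y ≡ Subset.∣ S ∣ ℕ.∸ 1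
    height-across′ {x = x} {y} N x∈B y∈A
      rewrite Dec.dec-false (x Fin.≟ y) (λ { refl → disjoint y∈A x∈B })
            | both⁻ˡ {t = l} {y = y} (λ x∈l → disjoint (sound L x∈l) x∈B)
            | both⁻ʳ {t = r} {x = x} (λ y∈r → disjoint y∈A (sound R y∈r)) = cong (ℕ._∸ 1) (size N)

  spanningHierarchy : Spans t Subset.⊤ → Hierarchy n
  spanningHierarchy {t} spans = record
    { tree   = t
    ; leaves = ∼bag⇒↭ (unique∧set⇒bag (unique spans) (Unique.allFin⁺ n)
        (mk⇔ (λ _ → ∈-allFin _) (λ _ → complete spans Subset.∈⊤)))
    }

module _ {n : ℕ} (G : WeightedGraph n) (isTree : IsTree G) where
  open WeightedGraph G
  open IsTree isTree

  weight-nonNeg : ∀ {x y} → T (E x y) → EventuallyNonNeg (w x y)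
  weight-nonNeg {x} {y} xy = pos⇒nonNeg {w x y} (w-pos xy)

  W-nonNeg : ∀ S → EventuallyNonNeg (W G S)
  W-nonNeg S = ∑-nonNeg {F = induced E S} {w} λ x y xy → weight-nonNeg (proj₁ (induced⁻ E S {x} {y} xy))

  module _ {S A B : Subset n} {x y : Fin n} (s : Split G S A B x y) where

    Split-W : ∃[ a ] ∃[ b ] T (E a b) × W G S ≐ W G A + (W G B + w a b)
    Split-W with Split-∑ G s w
    ... | _ , _ , inj₁ (refl , refl) , eq = _ , _ , Split.edge s , eq
    ... | _ , _ , inj₂ (refl , refl) , eq = _ , _ , edge-sym G (Split.edge s) , eq

    W-superadditive : W G A + W G B ≼ W G S
    W-superadditive =
      let a , b , ab , eq = Split-W in begin
      W G A + W G B                   ∼⟨ pointwise-≡ (λ k → sym (ℚ.+-identityʳ _)) ⟩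
      (W G A + W G B) + 0ℝ            ∼⟨ +-mono-≼ (≼-refl {W G A + W G B}) (nonNeg⇒0≼ (weight-nonNeg ab)) ⟩
      (W G A + W G B) + w a b
        ∼⟨ pointwise-≡ (λ k → trans (ℚ.+-assoc (seq (W G A) k) (seq (W G B) k) (seq (w a b) k)) (sym (eq k))) ⟩
      W G S                           ∎
      where open ≼-Reasoning

  module _ (Δ : ℕ) (2≤Δ : 2 ≤ℕ Δ) (Λ : ℝ) (0≤Λ : EventuallyNonNeg Λ)
           (light : HasBalancedLightEdges G Δ 2≤Δ Λ) where

    record BuiltTree (S : Subset n) (k : ℕ) : Set where
      field
        tree      : Tree ⊤ (Fin n)
        spans     : Spans tree S
        dominates : ∀ {x y} → x ∈ S → y ∈ S → Σ[ p ∈ Walk E x y ] length {E = E} p ≤ℕ height tree x y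
        cost      : ∑[xy∈ induced E S ] (λ x y → w x y * fromℕ (height tree x y)) ≼ Λ * fromℕ k * W G S

    singleton-tree : ∀ {S} k → 1 ≤ℕ Subset.∣ S ∣ → Subset.∣ S ∣ ≤ℕ 1 → BuiltTree S k
    singleton-tree {S} k 1≤∣S∣ ∣S∣≤1 = let v , v∈S = ∣p∣≥1⇒nonempty 1≤∣S∣ in record
      { tree      = leaf v
      ; spans     = leaf-spans v v∈S (ℕ.≤-antisym ∣S∣≤1 1≤∣S∣)
      ; dominates = λ {x} x∈S y∈S → subst (λ y → Σ[ p ∈ Walk E x y ] length {E = E} p ≤ℕ height (leaf v) x y)
          (∣p∣≤1⇒≡ ∣S∣≤1 x∈S y∈S) (ε , ℕ.z≤n)
      ; cost      = begin
          ∑[xy∈ induced E S ] (λ x y → w x y * fromℕ (height (leaf v) x y))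
            ∼⟨ ∑-mono {F = induced E S} (λ _ _ → refl) (λ x y _ → pointwise-≡ λ k →
                 trans (cong (λ m → seq (w x y) k ℚ.* fromℕ-ℚ m) (height-leaf {x = x} {y} v))
                   (trans (ℚ.*-zeroʳ (seq (w x y) k)) (sym (ℚ.*-zeroˡ (seq (w x y) k))))) ⟩
          ∑[xy∈ induced E S ] (λ x y → 0ℝ * w x y)
            ∼⟨ pointwise-≡ (λ k → trans (∑-* (induced E S) 0ℝ w k) (ℚ.*-zeroˡ (seq (W G S) k))) ⟩
          0ℝ
            ∼⟨ nonNeg⇒0≼ (*-nonNegℝ {Λ * fromℕ k} {W G S} (*-nonNegℝ {Λ} {fromℕ k} 0≤Λ (fromℕ-nonNeg k)) (W-nonNeg S)) ⟩
          Λ * fromℕ k * W G S ∎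
      }
      where open ≼-Reasoning


    light-edge-cost : ∀ {S x y} (2≤∣S∣ : 2 ≤ℕ Subset.∣ S ∣) →
      w x y ≼ Λ * (W G S ÷ℕ (Subset.∣ S ∣ ℕ.∸ 1)) {{pred-nonZero 2≤∣S∣}} →
      w x y * fromℕ (Subset.∣ S ∣ ℕ.∸ 1) ≼ Λ * W G S
    light-edge-cost {S} {x} {y} 2≤∣S∣ wxy≼ = begin
      w x y * fromℕ m                        ∼⟨ *-monoˡ-≼ (fromℕ m) (fromℕ-nonNeg m) wxy≼ ⟩
      Λ * (W G S ÷ℕ m) * fromℕ m             ∼⟨ pointwise-≡ (λ k → trans
        (solve 4 (λ l v i m → l :* (v :* i) :* m := l :* (v :* (m :* i))) refl
          (seq Λ k) (seq (W G S) k) (+ 1 ℚ./ m) (fromℕ-ℚ m))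
        (cong (λ u → seq Λ k ℚ.* u) (trans (cong (seq (W G S) k ℚ.*_) (*-/-cancel 1 m)) (ℚ.*-identityʳ _)))) ⟩
      Λ * W G S                              ∎
      where
      open ≼-Reasoning
      open +-*-Solver
      m : ℕ
      m = Subset.∣ S ∣ ℕ.∸ 1
      instance
        m≢0 : ℕ.NonZero m
        m≢0 = pred-nonZero 2≤∣S∣

    join-trees : ∀ {S A B x y} k → ConnectedOn E S → Split G S A B x y →
      w x y * fromℕ (Subset.∣ S ∣ ℕ.∸ 1) ≼ Λ * W G S → BuiltTree A k → BuiltTree B k → BuiltTree S (suc k)
    join-trees {S} {A} {B} {x} {y} k conn s edge-cost TA TB = record
      { tree      = t
      ; spans     = t-spans
      ; dominates = dominates
      ; cost      = cost
      }
      where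
      open Split s using (x∈A; y∈B; A⊆S; B⊆S; cover; disjoint)
      module TA = BuiltTree TA
      module TB = BuiltTree TB

      m : ℕ
      m = Subset.∣ S ∣ ℕ.∸ 1

      t : Tree ⊤ (Fin n)
      t = node TA.tree tt TB.tree

      t-spans : Spans t S
      t-spans = node-spans TA.spans TB.spans disjoint A⊆S B⊆S cover (Split.∣S∣≡∣A∣+∣B∣ s)

      across : ∀ {p q} → p ∈ A → q ∈ B → height t p q ≡ m
      across = height-across TA.spans TB.spans disjoint t-spans

      across′ : ∀ {p q} → p ∈ B → q ∈ A → height t p q ≡ m
      across′ = height-across′ TA.spans TB.spans disjoint t-spans

      left : ∀ {p q} → p ∈ A → q ∈ A → height t p q ≡ height TA.tree p q
      left = height-left TA.spans TB.spans disjoint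

      right : ∀ {p q} → p ∈ B → q ∈ B → height t p q ≡ height TB.tree p q
      right = height-right TA.spans TB.spans disjoint

      Dominated : Fin n → Fin n → ℕ → Set
      Dominated p q h = Σ[ r ∈ Walk E p q ] length {E = E} r ≤ℕ h

      dominates : ∀ {p q} → p ∈ S → q ∈ S → Dominated p q (height t p q)
      dominates {p} {q} p∈S q∈S = by-sides (cover p∈S) (cover q∈S)
        where
        by-sides : p ∈ A ⊎ p ∈ B → q ∈ A ⊎ q ∈ B → Dominated p q (height t p q)
        by-sides (inj₁ p∈A) (inj₁ q∈A) = subst (Dominated p q) (sym (left p∈A q∈A)) (TA.dominates p∈A q∈A)
        by-sides (inj₂ p∈B) (inj₂ q∈B) = subst (Dominated p q) (sym (right p∈B q∈B)) (TB.dominates p∈B q∈B)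
        by-sides (inj₁ p∈A) (inj₂ q∈B) = subst (Dominated p q) (sym (across p∈A q∈B)) (shortWalk {F = E} (conn p∈S q∈S) p∈S)
        by-sides (inj₂ p∈B) (inj₁ q∈A) = subst (Dominated p q) (sym (across′ p∈B q∈A)) (shortWalk {F = E} (conn p∈S q∈S) p∈S)

      f : Fin n → Fin n → ℝ
      f p q = w p q * fromℕ (height t p q)

      term-cong : ∀ {p q} (t′ : Tree ⊤ (Fin n)) → height t p q ≡ height t′ p q → f p q ≼ w p q * fromℕ (height t′ p q)
      term-cong {p} {q} t′ eq = pointwise-≡ λ k → cong (λ h → seq (w p q) k ℚ.* fromℕ-ℚ h) eq

      cut-term : ∀ {a b} → (a ≡ x × b ≡ y) ⊎ (a ≡ y × b ≡ x) → f a b ≼ w x y * fromℕ m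
      cut-term (inj₁ (refl , refl)) = pointwise-≡ λ k → cong (λ h → seq (w x y) k ℚ.* fromℕ-ℚ h) (across x∈A y∈B)
      cut-term (inj₂ (refl , refl)) = begin
        f y x                ∼⟨ pointwise-≡ (λ k → cong (λ h → seq (w y x) k ℚ.* fromℕ-ℚ h) (across′ y∈B x∈A)) ⟩
        w y x * fromℕ m      ∼⟨ *-monoˡ-≼ (fromℕ m) (fromℕ-nonNeg m) (≃⇒≼ {w y x} {w x y} (w-sym (edge-sym G (Split.edge s)))) ⟩
        w x y * fromℕ m      ∎
        where open ≼-Reasoning

      cost : ∑[xy∈ induced E S ] f ≼ Λ * fromℕ (suc k) * W G S
      cost =
        let a , b , ab , eq = Split-∑ G s f in begin
        ∑[xy∈ induced E S ] f
          ∼⟨ pointwise-≡ eq ⟩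
        ∑[xy∈ induced E A ] f + (∑[xy∈ induced E B ] f + f a b)
          ∼⟨ +-mono-≼
               (∑-mono {F = induced E A} (λ _ _ → refl) λ p q pq →
                 let _ , p∈A , q∈A = induced⁻ E A {p} {q} pq in term-cong TA.tree (left p∈A q∈A))
               (+-mono-≼
                 (∑-mono {F = induced E B} (λ _ _ → refl) λ p q pq →
                   let _ , p∈B , q∈B = induced⁻ E B {p} {q} pq in term-cong TB.tree (right p∈B q∈B))
                 (cut-term ab)) ⟩
        ∑[xy∈ induced E A ] (λ p q → w p q * fromℕ (height TA.tree p q)) +
          (∑[xy∈ induced E B ] (λ p q → w p q * fromℕ (height TB.tree p q)) + w x y * fromℕ m)
          ∼⟨ +-mono-≼ TA.cost (+-mono-≼ TB.cost edge-cost) ⟩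
        Λ * fromℕ k * W G A + (Λ * fromℕ k * W G B + Λ * W G S)
          ∼⟨ pointwise-≡ (λ i → solve 5 (λ l k a b s → l :* k :* a :+ (l :* k :* b :+ l :* s) := l :* k :* (a :+ b) :+ l :* s) refl
               (seq Λ i) (fromℕ-ℚ k) (seq (W G A) i) (seq (W G B) i) (seq (W G S) i)) ⟩
        Λ * fromℕ k * (W G A + W G B) + Λ * W G S
          ∼⟨ +-mono-≼ (*-monoʳ-≼ (Λ * fromℕ k) (*-nonNegℝ {Λ} {fromℕ k} 0≤Λ (fromℕ-nonNeg k)) (W-superadditive s))
               (≼-refl {Λ * W G S}) ⟩
        Λ * fromℕ k * W G S + Λ * W G S
          ∼⟨ pointwise-≡ (λ i → trans
               (solve 3 (λ l k s → l :* k :* s :+ l :* s := l :* (con 1ℚ :+ k) :* s) refl (seq Λ i) (fromℕ-ℚ k) (seq (W G S) i))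
               (cong (λ u → seq Λ i ℚ.* u ℚ.* seq (W G S) i) (sym (fromℕ-ℚ-+ 1 k)))) ⟩
        Λ * fromℕ (suc k) * W G S ∎
        where
        open ≼-Reasoning
        open +-*-Solver

    build : ∀ k S → ConnectedOn E S → 1 ≤ℕ Subset.∣ S ∣ →
      fromℕ-ℚ (Subset.∣ S ∣ ℕ.∸ 1) ℚ.< Δ/[Δ-1] Δ 2≤Δ ^ℚ k → BuiltTree S k
    build k S conn 1≤∣S∣ bound with Subset.∣ S ∣ ℕ.≤? 1
    ... | yes ∣S∣≤1 = singleton-tree k 1≤∣S∣ ∣S∣≤1
    build zero    S conn 1≤∣S∣ bound | no ∣S∣≰1 =
      contradiction (ℕ.m∸n≡0⇒m≤n (fromℕ-ℚ<1 bound)) ∣S∣≰1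
    build (suc k) S conn 1≤∣S∣ bound | no ∣S∣≰1 = join-trees k conn s
      (light-edge-cost {S} {cut.x} {cut.y} 2≤∣S∣ (≼⁺ cut.light))
      (build k A connᴬ 1≤∣A∣ (bound′ (ℕ.m≤m⊔n a b)))
      (build k B connᴮ 1≤∣B∣ (bound′ (ℕ.m≤n⊔m a b)))
      where
      2≤∣S∣ : 2 ≤ℕ Subset.∣ S ∣
      2≤∣S∣ = ℕ.≰⇒> ∣S∣≰1
      module cut = BalancedLightEdge (light S conn 2≤∣S∣)
      open cut using (A; B)
      s : Split G S A B cut.x cut.y
      s = components-split G acyclic conn cut.xy∈G[S] cut.A-comp cut.B-comp
      open Split s using (connᴬ; connᴮ; 1≤∣A∣; 1≤∣B∣)
      a b : ℕ
      a = Subset.∣ A ∣ ℕ.∸ 1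
      b = Subset.∣ B ∣ ℕ.∸ 1
      bound′ : ∀ {c} → c ≤ℕ a ℕ.⊔ b → fromℕ-ℚ c ℚ.< Δ/[Δ-1] Δ 2≤Δ ^ℚ k
      bound′ {c} c≤ = shrink Δ 2≤Δ {fromℕ-ℚ c} {fromℕ-ℚ (Subset.∣ S ∣ ℕ.∸ 1)} k
        (ℚ.≤-trans (fromℕ-ℚ-mono c≤) cut.balanced) bound

module _ {n : ℕ} (G : WeightedGraph n) (isTree : IsTree G) where
  open WeightedGraph G
  open IsTree isTree

  induced-⊤ : ∀ x y → induced E Subset.⊤ x y ≡ E x y
  induced-⊤ x y rewrite Vec.lookup-replicate x true | Vec.lookup-replicate y true with E x y
  ... | true  = refl
  ... | false = refl

  ⊤-connected : ConnectedOn E Subset.⊤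
  ⊤-connected {x} {y} _ _ = Star.map (λ {a} {b} e → subst T (sym (induced-⊤ a b)) e) (connected x y)

  edge-distance : ∀ {x y} → T (E x y) → IsDistance G x y 1
  edge-distance xy = record
    { attained = xy ◅ ε , refl
    ; isLower  = λ { ε → contradiction refl (edge⇒≢ G xy) ; (_ ◅ _) → ℕ.s≤s ℕ.z≤n }
    }

  -- An ultrametric is at least 1 on edges.
  W≼freeCost : ∀ U → W G Subset.⊤ ≼ freeCost G U
  W≼freeCost U = ∑-mono {F = induced E Subset.⊤} {E} induced-⊤ λ x y xy →
    let e = subst T (induced-⊤ x y) xy in begin
    w x y                  ∼⟨ pointwise-≡ (λ k → sym (ℚ.*-identityʳ (seq (w x y) k))) ⟩
    w x y * fromℕ 1        ∼⟨ *-monoʳ-≼ (w x y) (weight-nonNeg G isTree e) (≼⁺ (u≥d x y 1 (edge-distance e))) ⟩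
    w x y * u x y          ∎
    where
    open ≼-Reasoning
    open FeasibleUltrametric U

  weight≼W : ∀ {S A B x y} → Split G S A B x y → ∃[ a ] ∃[ b ] T (E a b) × w a b ≼ W G S
  weight≼W {S} {A} {B} s =
    let a , b , ab , eq = Split-W G isTree s in a , b , ab , (begin
    w a b                               ∼⟨ pointwise-≡ (λ k → sym (trans (ℚ.+-identityˡ _) (ℚ.+-identityˡ _))) ⟩
    0ℝ + (0ℝ + w a b)                   ∼⟨ +-mono-≼ (nonNeg⇒0≼ (W-nonNeg G isTree A))
                                             (+-mono-≼ (nonNeg⇒0≼ (W-nonNeg G isTree B)) ≼-refl) ⟩
    W G A + (W G B + w a b)             ∼⟨ pointwise-≡ (λ k → sym (eq k)) ⟩
    W G S                               ∎)
    where open ≼-Reasoning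

  module _ (Δ : ℕ) (2≤Δ : 2 ≤ℕ Δ) (Λ : ℝ) (2≤n : 2 ≤ℕ n) (light : HasBalancedLightEdges G Δ 2≤Δ Λ) where
    private
      ∣⊤∣≡n : Subset.∣ Subset.⊤ {n} ∣ ≡ n
      ∣⊤∣≡n = Subset.∣⊤∣≡n n

      2≤∣⊤∣ : 2 ≤ℕ Subset.∣ Subset.⊤ {n} ∣
      2≤∣⊤∣ = subst (2 ≤ℕ_) (sym ∣⊤∣≡n) 2≤n

      module cut = BalancedLightEdge (light Subset.⊤ ⊤-connected 2≤∣⊤∣)

      0<W : 0ℝ < W G Subset.⊤
      0<W =
        let a , b , ab , wab≼W = weight≼W (components-split G acyclic ⊤-connected cut.xy∈G[S] cut.A-comp cut.B-comp)
        in pos-upwards {w a b} (w-pos ab) wab≼W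

      0≤Λ : EventuallyNonNeg Λ
      0≤Λ = nonNeg-*-cancelʳ {Λ} {(W G Subset.⊤ ÷ℕ m) {{m≢0}}}
        (*-nonNegℝ {W G Subset.⊤} {fromℚ ((+ 1 ℚ./ m) {{m≢0}})} (W-nonNeg G isTree Subset.⊤)
          (fromℚ-nonNeg (ℚ.nonNegative⁻¹ _ {{ℚ.normalize-nonNeg 1 m {{m≢0}}}})))
        (pos-upwards {w cut.x cut.y} {Λ * (W G Subset.⊤ ÷ℕ m) {{m≢0}}} (w-pos (proj₁ (induced⁻ E Subset.⊤ cut.xy∈G[S]))) (≼⁺ cut.light))
        where
        m : ℕ
        m = Subset.∣ Subset.⊤ {n} ∣ ℕ.∸ 1
        m≢0 : ℕ.NonZero m
        m≢0 = pred-nonZero 2≤∣⊤∣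

    ratioBound : RatioBound G Δ 2≤Δ Λ
    ratioBound card free k card-min free-min log = 0<free , ≼⁻ (≼*⇒÷≼ {card} {Λ * fromℕ (suc k)} {free}
      (*-nonNegℝ {Λ} {fromℕ (suc k)} 0≤Λ (fromℕ-nonNeg (suc k))) 0<free (begin
        card                                   ∼⟨ ≼⁺ (IsMinimum.isLower card-min hierarchy) ⟩
        cardCost G hierarchy
          ∼⟨ ∑-mono {F = E} {induced E Subset.⊤} (λ x y → sym (induced-⊤ x y)) (λ _ _ _ → ≼-refl) ⟩
        ∑[xy∈ induced E Subset.⊤ ] (λ x y → w x y * fromℕ (height built.tree x y))
                                               ∼⟨ built.cost ⟩
        Λ * fromℕ (suc k) * W G Subset.⊤       ∼⟨ *-monoʳ-≼ (Λ * fromℕ (suc k))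
                                                    (*-nonNegℝ {Λ} {fromℕ (suc k)} 0≤Λ (fromℕ-nonNeg (suc k))) W≼free ⟩
        Λ * fromℕ (suc k) * free               ∎))
      where
      open ≼-Reasoning

      W≼free : W G Subset.⊤ ≼ free
      W≼free = let U , cost≃free = IsMinimum.attained free-min in
        ≼-trans (W≼freeCost U) (≃⇒≼ {freeCost G U} {free} cost≃free)

      0<free : 0ℝ < free
      0<free = pos-upwards {W G Subset.⊤} 0<W W≼free

      module built = BuiltTree (build G isTree Δ 2≤Δ Λ 0≤Λ light (suc k) Subset.⊤ ⊤-connected
        (subst (1 ≤ℕ_) (sym ∣⊤∣≡n) (ℕ.<⇒≤ 2≤n))
        (subst (λ m → fromℕ-ℚ (m ℕ.∸ 1) ℚ.< Δ/[Δ-1] Δ 2≤Δ ^ℚ suc k) (sym ∣⊤∣≡n) (⌊log_⌋.upper log)))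

      hierarchy : FeasibleHierarchy G
      hierarchy = record
        { H   = spanningHierarchy built.spans
        ; h≥d = λ x y d dist → let p , p≤h = built.dominates {x} {y} Subset.∈⊤ Subset.∈⊤ in
            ℕ.≤-trans (IsMinimum.isLower dist p) p≤h
        }

-- Balanced edges

⋃⁺ : ∀ {n} {x : Fin n} {p ps} → x ∈ p → p ∈ᴸ ps → x ∈ Subset.⋃ ps
⋃⁺ {ps = p ∷ ps} x∈p (here refl)  = Subset.x∈p∪q⁺ (inj₁ x∈p)
⋃⁺ {ps = p ∷ ps} x∈p (there p∈ps) = Subset.x∈p∪q⁺ {p = p} (inj₂ (⋃⁺ x∈p p∈ps))

∣⋃∣≤ : ∀ {n} c {k} {ps : List (Subset n)} → All (λ p → c ℕ.* Subset.∣ p ∣ ≤ℕ k) ps →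
  c ℕ.* Subset.∣ Subset.⋃ ps ∣ ≤ℕ List.length ps ℕ.* k
∣⋃∣≤ {n} c [] = ℕ.≤-reflexive (trans (cong (c ℕ.*_) (Subset.∣⊥∣≡0 n)) (ℕ.*-zeroʳ c))
∣⋃∣≤ c {k} {p ∷ ps} (c∣p∣≤k ∷ rest) = begin
  c ℕ.* Subset.∣ p ∪ Subset.⋃ ps ∣                           ≤⟨ ℕ.*-monoʳ-≤ c (∣p∪q∣≤∣p∣+∣q∣ p (Subset.⋃ ps)) ⟩
  c ℕ.* (Subset.∣ p ∣ ℕ.+ Subset.∣ Subset.⋃ ps ∣)            ≡⟨ ℕ.*-distribˡ-+ c Subset.∣ p ∣ Subset.∣ Subset.⋃ ps ∣ ⟩
  c ℕ.* Subset.∣ p ∣ ℕ.+ c ℕ.* Subset.∣ Subset.⋃ ps ∣        ≤⟨ ℕ.+-mono-≤ c∣p∣≤k (∣⋃∣≤ c rest) ⟩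
  k ℕ.+ List.length ps ℕ.* k                                 ∎
  where open ℕ.≤-Reasoning

module _ {n : ℕ} (G : WeightedGraph n) (isTree : IsTree G) where
  open WeightedGraph G
  open IsTree isTree

  module _ {S : Subset n} (conn : ConnectedOn E S) where

    someEdge : 2 ≤ℕ Subset.∣ S ∣ → ∃[ v ] ∃[ u ] T (induced E S v u)
    someEdge 2≤∣S∣ with ∣p∣≥1⇒nonempty (ℕ.<⇒≤ 2≤∣S∣)
    ... | v , v∈S with Fin.any? (λ u → (u Subset.∈? S) ×-dec ¬? (v Fin.≟ u))
    ...   | no none = contradiction
      (ℕ.≤-trans 2≤∣S∣ (ℕ.≤-trans (Subset.p⊆q⇒∣p∣≤∣q∣ S⊆⁅v⁆) (ℕ.≤-reflexive (Subset.∣⁅x⁆∣≡1 v)))) λ { (ℕ.s≤s ()) }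
      where
      S⊆⁅v⁆ : S ⊆ Subset.⁅ v ⁆
      S⊆⁅v⁆ {u} u∈S with v Fin.≟ u
      ... | yes refl = Subset.x∈⁅x⁆ v
      ... | no  v≢u  = contradiction (u , u∈S , v≢u) none
    ...   | yes (u , u∈S , v≢u) with conn v∈S u∈S
    ...     | ε     = contradiction refl v≢u
    ...     | e ◅ _ = v , _ , e

    near far : Fin n → Fin n → Subset n
    near v u = component (removeEdge (induced E S) v u) v
    far  v u = component (removeEdge (induced E S) v u) u

    edgeSplit : ∀ {v u} → T (induced E S v u) → Split G S (near v u) (far v u) v u
    edgeSplit {v} {u} vu = components-split G acyclic conn vu
      (component-isComponent (removeEdge (induced E S) v u) v)
      (component-isComponent (removeEdge (induced E S) v u) u)

    private
      R : Fin n → Fin n → EdgeSet n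
      R v u = removeEdge (induced E S) v u

      R⁺ : ∀ v u {a b} → T (induced E S a b) → ¬ (a ≡ v × b ≡ u) → ¬ (a ≡ u × b ≡ v) → T (R v u a b)
      R⁺ v u {a} {b} = removeEdge⁺ {F = induced E S} {a} {b}

      R⁻ : ∀ v u {a b} → T (R v u a b) → T (induced E S a b) × ¬ (a ≡ v × b ≡ u) × ¬ (a ≡ u × b ≡ v)
      R⁻ v u {a} {b} = removeEdge⁻ {F = induced E S} {a} {b}

      far⁺ : ∀ v u {z} → Walk (R v u) u z → z ∈ far v u
      far⁺ v u {z} = Equivalence.from (component-isComponent (R v u) u z)

      far⁻ : ∀ v u {z} → z ∈ far v u → Walk (R v u) u z
      far⁻ v u {z} = Equivalence.to (component-isComponent (R v u) u z)

      near⁻ : ∀ v u {z} → z ∈ near v u → Walk (R v u) v z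
      near⁻ v u {z} = Equivalence.to (component-isComponent (R v u) v z)

    near⊆far : ∀ v u → near v u ⊆ far u v
    near⊆far v u z∈ = far⁺ u v (Star.map (λ {a} {b} e → let ab , ¬vu , ¬uv = R⁻ v u {a} {b} e in R⁺ u v {a} {b} ab ¬uv ¬vu) (near⁻ v u z∈))

    Child : Fin n → Fin n → Fin n → Set
    Child v u u′ = T (induced E S u u′) × u′ ≢ v

    far-children : ∀ v u {z} → z ∈ far v u → z ≡ u ⊎ ∃[ u′ ] Child v u u′ × z ∈ far u u′
    far-children v u z∈ with walk-preserves {F = R v u} Branch (λ {a} {b} → step {a} {b}) (far⁻ v u z∈) (inj₁ refl)
      where
      Branch : Fin n → Set
      Branch z = z ≡ u ⊎ ∃[ u′ ] Child v u u′ × Walk (R u u′) u′ z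
      step : ∀ {a b} → T (R v u a b) → Branch a → Branch b
      step {a} {b} e branch with R⁻ v u {a} {b} e | a Fin.≟ u | b Fin.≟ u | branch
      ... | ab , _ , ¬uv | yes refl | _        | _ = inj₂ (b , (ab , λ b≡v → ¬uv (refl , b≡v)) , ε)
      ... | _            | no _     | yes b≡u  | _ = inj₁ b≡u
      ... | _            | no a≢u   | no _     | inj₁ a≡u = contradiction a≡u a≢u
      ... | ab , _       | no a≢u   | no b≢u   | inj₂ (u′ , child , p) =
        inj₂ (u′ , child , snoc {F = R u u′} p (R⁺ u u′ {a} {b} ab (a≢u ∘ proj₁) (b≢u ∘ proj₂)))
    ... | inj₁ z≡u = inj₁ z≡u
    ... | inj₂ (u′ , child , p) = inj₂ (u′ , child , far⁺ u u′ p)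

    module _ {v u u′ : Fin n} (vu : T (induced E S v u)) (child : Child v u u′) where
      private
        v≢u : v ≢ u
        v≢u = edge⇒≢ G (proj₁ (induced⁻ E S vu))

        uu′ : T (induced E S u u′)
        uu′ = proj₁ child

      u∉far : u ∉ far u u′
      u∉far = Split.disjoint (edgeSplit uu′) (Split.x∈A (edgeSplit uu′))

      far-child⊆far : far u u′ ⊆ far v u
      far-child⊆far z∈ = far⁺ v u (proj₂ (walk-preserves {F = R u u′}
        (λ z → Walk (R u u′) u′ z × Walk (R v u) u z) (λ {a} {b} → step {a} {b}) (far⁻ u u′ z∈)
        (ε , R⁺ v u {u} {u′} uu′ (λ (u≡v , _) → v≢u (sym u≡v)) (proj₂ child ∘ proj₂) ◅ ε)))
        where
        step : ∀ {a b} → T (R u u′ a b) → Walk (R u u′) u′ a × Walk (R v u) u a → Walk (R u u′) u′ b × Walk (R v u) u b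
        step {a} {b} e (p , q) =
          let p′ = snoc {F = R u u′} p e in
          p′ , snoc {F = R v u} q (R⁺ v u {a} {b} (proj₁ (R⁻ u u′ {a} {b} e))
            (λ { (_ , refl) → u∉far (far⁺ u u′ p′) })
            (λ { (refl , _) → u∉far (far⁺ u u′ p) }))

      ∣far-child∣<∣far∣ : Subset.∣ far u u′ ∣ ℕ.< Subset.∣ far v u ∣
      ∣far-child∣<∣far∣ = Subset.p⊂q⇒∣p∣<∣q∣ (far-child⊆far , u , far⁺ v u ε , u∉far)

    module _ (Δ : ℕ) (2≤Δ : 2 ≤ℕ Δ) (maxDegree : MaxDegree≤ G Δ) where
      private
        m : ℕ
        m = Subset.∣ S ∣ ℕ.∸ 1

      BalancedEdge : Set
      BalancedEdge = ∃[ v ] ∃[ u ] T (induced E S v u) ×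
        Δ ℕ.* ((Subset.∣ near v u ∣ ℕ.∸ 1) ℕ.⊔ (Subset.∣ far v u ∣ ℕ.∸ 1)) ≤ℕ (Δ ℕ.∸ 1) ℕ.* m

      module _ {v u : Fin n} (vu : T (induced E S v u)) where
        private
          Child? : ∀ u′ → Dec (Child v u u′)
          Child? u′ = T? (induced E S u u′) ×-dec ¬? (u′ Fin.≟ v)

          children : List (Fin n)
          children = List.filter Child? (List.allFin n)

          ∣children∣≤Δ-1 : List.length children ≤ℕ Δ ℕ.∸ 1
          ∣children∣≤Δ-1 = ℕ.≤-trans
            (unique⇒length≤∣p∣ (Unique.filter⁺ Child? (Unique.allFin⁺ n))
              (All.map {P = Child v u} child∈ (All.all-filter Child? (List.allFin n))))
            (ℕ.∸-monoˡ-≤ 1 (ℕ.≤-trans (Subset.x∈p⇒∣p-x∣<∣p∣ (∈neighbours (edge-sym G (proj₁ (induced⁻ E S vu))))) (maxDegree u)))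
            where
            ∈neighbours : ∀ {u′} → T (E u u′) → u′ ∈ neighbours E u
            ∈neighbours {u′} uu′ = T⇒∈ (subst T (sym (Vec.lookup∘tabulate (E u) u′)) uu′)
            child∈ : ∀ {u′} → Child v u u′ → u′ ∈ neighbours E u Subset.- v
            child∈ (uu′ , u′≢v) = Subset.x∈p∧x≢y⇒x∈p-y (∈neighbours (proj₁ (induced⁻ E S uu′))) u′≢v

          far⊆ : far v u ⊆ Subset.⁅ u ⁆ ∪ Subset.⋃ (List.map (far u) children)
          far⊆ z∈ with far-children v u z∈
          ... | inj₁ refl = Subset.x∈p∪q⁺ (inj₁ (Subset.x∈⁅x⁆ u))
          ... | inj₂ (u′ , child , z∈′) = Subset.x∈p∪q⁺ {p = Subset.⁅ u ⁆}
            (inj₂ (⋃⁺ z∈′ (∈-map⁺ (far u) (∈-filter⁺ Child? (∈-allFin u′) child))))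

        all-children-small : (∀ u′ → Child v u u′ → Δ ℕ.* Subset.∣ far u u′ ∣ ≤ℕ m) →
          Δ ℕ.* (Subset.∣ far v u ∣ ℕ.∸ 1) ≤ℕ (Δ ℕ.∸ 1) ℕ.* m
        all-children-small small = begin
          Δ ℕ.* (Subset.∣ far v u ∣ ℕ.∸ 1)                               ≤⟨ ℕ.*-monoʳ-≤ Δ (ℕ.∸-monoˡ-≤ 1 ∣far∣≤) ⟩
          Δ ℕ.* Subset.∣ Subset.⋃ (List.map (far u) children) ∣
            ≤⟨ ∣⋃∣≤ Δ (All.map⁺ (All.map {P = Child v u} (λ {u′} → small u′) (All.all-filter Child? (List.allFin n)))) ⟩
          List.length (List.map (far u) children) ℕ.* m                  ≡⟨ cong (ℕ._* m) (List.length-map (far u) children) ⟩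
          List.length children ℕ.* m                                     ≤⟨ ℕ.*-monoˡ-≤ m ∣children∣≤Δ-1 ⟩
          (Δ ℕ.∸ 1) ℕ.* m                                                ∎
          where
          open ℕ.≤-Reasoning
          ∣far∣≤ : Subset.∣ far v u ∣ ≤ℕ 1 ℕ.+ Subset.∣ Subset.⋃ (List.map (far u) children) ∣
          ∣far∣≤ = ℕ.≤-trans (Subset.p⊆q⇒∣p∣≤∣q∣ far⊆)
            (subst (λ i → Subset.∣ Subset.⁅ u ⁆ ∪ Subset.⋃ (List.map (far u) children) ∣ ≤ℕ i ℕ.+ Subset.∣ Subset.⋃ (List.map (far u) children) ∣) (Subset.∣⁅x⁆∣≡1 u)
              (∣p∪q∣≤∣p∣+∣q∣ Subset.⁅ u ⁆ (Subset.⋃ (List.map (far u) children))))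

        far-large⇒near-small : m ≤ℕ Δ ℕ.* Subset.∣ far v u ∣ → Δ ℕ.* (Subset.∣ near v u ∣ ℕ.∸ 1) ≤ℕ (Δ ℕ.∸ 1) ℕ.* m
        far-large⇒near-small large = begin
          Δ ℕ.* a                             ≡⟨ ℕ.m+n∸n≡m (Δ ℕ.* a) (Δ ℕ.* b) ⟨
          Δ ℕ.* a ℕ.+ Δ ℕ.* b ℕ.∸ Δ ℕ.* b
            ≡⟨ cong (ℕ._∸ Δ ℕ.* b) (trans (sym (ℕ.*-distribˡ-+ Δ a b)) (cong (Δ ℕ.*_) (sym m≡a+b))) ⟩
          Δ ℕ.* m ℕ.∸ Δ ℕ.* b                 ≤⟨ ℕ.∸-monoʳ-≤ (Δ ℕ.* m) large ⟩
          Δ ℕ.* m ℕ.∸ m                       ≡⟨ cong (Δ ℕ.* m ℕ.∸_) (ℕ.*-identityˡ m) ⟨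
          Δ ℕ.* m ℕ.∸ 1 ℕ.* m                 ≡⟨ ℕ.*-distribʳ-∸ m Δ 1 ⟨
          (Δ ℕ.∸ 1) ℕ.* m                     ∎
          where
          open ℕ.≤-Reasoning
          open Split (edgeSplit vu) using (∣S∣≡∣A∣+∣B∣; 1≤∣A∣)
          a b : ℕ
          a = Subset.∣ near v u ∣ ℕ.∸ 1
          b = Subset.∣ far v u ∣
          m≡a+b : m ≡ a ℕ.+ b
          m≡a+b = trans (cong (ℕ._∸ 1) ∣S∣≡∣A∣+∣B∣) (ℕ.+-∸-comm b 1≤∣A∣)

      descend : ∀ k {v u} → T (induced E S v u) → Subset.∣ far v u ∣ ≤ℕ k → m ≤ℕ Δ ℕ.* Subset.∣ far v u ∣ → BalancedEdge
      descend k {v} {u} vu ∣far∣≤k large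
        with Fin.any? (λ u′ → (T? (induced E S u u′) ×-dec ¬? (u′ Fin.≟ v)) ×-dec (m ℕ.≤? Δ ℕ.* Subset.∣ far u u′ ∣))
      ... | no none = v , u , vu , ℕ.≤-trans (ℕ.≤-reflexive (ℕ.*-distribˡ-⊔ Δ _ _)) (ℕ.⊔-lub
        (far-large⇒near-small vu large)
        (all-children-small vu λ u′ child → ℕ.<⇒≤ (ℕ.≰⇒> λ large′ → none (u′ , child , large′))))
      descend zero    vu ∣far∣≤0 large | yes (u′ , child , _) =
        contradiction (ℕ.≤-trans (∣far-child∣<∣far∣ vu child) ∣far∣≤0) λ ()
      descend (suc k) vu ∣far∣≤k large | yes (u′ , child , large′) =
        descend k (proj₁ child) (ℕ.s≤s⁻¹ (ℕ.≤-trans (∣far-child∣<∣far∣ vu child) ∣far∣≤k)) large′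

      balancedEdge : 2 ≤ℕ Subset.∣ S ∣ → BalancedEdge
      balancedEdge 2≤∣S∣ with someEdge 2≤∣S∣
      ... | v , u , vu with m ℕ.≤? Δ ℕ.* Subset.∣ far v u ∣
      ...   | yes large = descend _ vu ℕ.≤-refl large
      ...   | no small  = descend _ (induced-sym G {S} vu) ℕ.≤-refl
        (ℕ.≤-trans near-large (ℕ.*-monoʳ-≤ Δ (Subset.p⊆q⇒∣p∣≤∣q∣ (near⊆far v u))))
        where
        open ℕ.≤-Reasoning
        near-large : m ≤ℕ Δ ℕ.* Subset.∣ near v u ∣
        near-large = ℕ.+-cancelʳ-≤ m m (Δ ℕ.* Subset.∣ near v u ∣) (begin
          m ℕ.+ m                                                       ≡⟨ cong (m ℕ.+_) (ℕ.+-identityʳ m) ⟨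
          2 ℕ.* m                                                       ≤⟨ ℕ.*-monoˡ-≤ m 2≤Δ ⟩
          Δ ℕ.* m                                                       ≤⟨ ℕ.*-monoʳ-≤ Δ (ℕ.m∸n≤m Subset.∣ S ∣ 1) ⟩
          Δ ℕ.* Subset.∣ S ∣                                            ≡⟨ cong (Δ ℕ.*_) (Split.∣S∣≡∣A∣+∣B∣ (edgeSplit vu)) ⟩
          Δ ℕ.* (Subset.∣ near v u ∣ ℕ.+ Subset.∣ far v u ∣)
            ≡⟨ ℕ.*-distribˡ-+ Δ Subset.∣ near v u ∣ Subset.∣ far v u ∣ ⟩
          Δ ℕ.* Subset.∣ near v u ∣ ℕ.+ Δ ℕ.* Subset.∣ far v u ∣
            ≤⟨ ℕ.+-monoʳ-≤ (Δ ℕ.* Subset.∣ near v u ∣) (ℕ.<⇒≤ (ℕ.≰⇒> small)) ⟩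
          Δ ℕ.* Subset.∣ near v u ∣ ℕ.+ m                               ∎)

module _ {n : ℕ} (G : WeightedGraph n) (isTree : IsTree G) where
  open WeightedGraph G
  open IsTree isTree

  minWeight-split : ∀ {μ S A B v u} → (∀ {x y} → T (E x y) → μ ≼ w x y) → Split G S A B v u →
    μ * fromℕ (Subset.∣ A ∣ ℕ.∸ 1) ≼ W G A → μ * fromℕ (Subset.∣ B ∣ ℕ.∸ 1) ≼ W G B →
    μ * fromℕ (Subset.∣ S ∣ ℕ.∸ 1) ≼ W G S
  minWeight-split {μ} {S} {A} {B} μ≼w s IHᴬ IHᴮ =
    let v , u , vu , eq = Split-W G isTree s in begin
    μ * fromℕ (Subset.∣ S ∣ ℕ.∸ 1)
      ∼⟨ pointwise-≡ (λ i → trans (cong (λ d → seq μ i ℚ.* fromℕ-ℚ d) ∣S∣-1≡) (distrib (seq μ i))) ⟩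
    μ * fromℕ a + (μ * fromℕ b + μ)       ∼⟨ +-mono-≼ IHᴬ (+-mono-≼ IHᴮ (μ≼w vu)) ⟩
    W G A + (W G B + w v u)               ∼⟨ pointwise-≡ (λ i → sym (eq i)) ⟩
    W G S                                 ∎
    where
    open ≼-Reasoning
    open Split s using (1≤∣A∣; 1≤∣B∣; ∣S∣≡∣A∣+∣B∣)
    a b : ℕ
    a = Subset.∣ A ∣ ℕ.∸ 1
    b = Subset.∣ B ∣ ℕ.∸ 1

    ∣S∣-1≡ : Subset.∣ S ∣ ℕ.∸ 1 ≡ a ℕ.+ suc b
    ∣S∣-1≡ = trans (cong (ℕ._∸ 1) ∣S∣≡∣A∣+∣B∣) (trans (ℕ.+-∸-comm Subset.∣ B ∣ 1≤∣A∣)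
      (cong (a ℕ.+_) (sym (ℕ.m+[n∸m]≡n 1≤∣B∣))))

    distrib : ∀ p → p ℚ.* fromℕ-ℚ (a ℕ.+ suc b) ≡ p ℚ.* fromℕ-ℚ a ℚ.+ (p ℚ.* fromℕ-ℚ b ℚ.+ p)
    distrib p = trans
      (cong (p ℚ.*_) (trans (fromℕ-ℚ-+ a (suc b)) (cong (fromℕ-ℚ a ℚ.+_) (fromℕ-ℚ-+ 1 b))))
      (solve 3 (λ p a b → p :* (a :+ (con 1ℚ :+ b)) := p :* a :+ (p :* b :+ p)) refl p (fromℕ-ℚ a) (fromℕ-ℚ b))
      where open +-*-Solver

  minWeight-W : ∀ {μ} → (∀ {x y} → T (E x y) → μ ≼ w x y) → ∀ k S → ConnectedOn E S →
    1 ≤ℕ Subset.∣ S ∣ → Subset.∣ S ∣ ≤ℕ suc k → μ * fromℕ (Subset.∣ S ∣ ℕ.∸ 1) ≼ W G S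
  minWeight-W {μ} μ≼w k S conn 1≤∣S∣ ∣S∣≤ = by-size k ∣S∣≤ (Subset.∣ S ∣ ℕ.≤? 1)
    where
    by-size : ∀ k → Subset.∣ S ∣ ≤ℕ suc k → Dec (Subset.∣ S ∣ ≤ℕ 1) → μ * fromℕ (Subset.∣ S ∣ ℕ.∸ 1) ≼ W G S
    by-size k       _       (yes ∣S∣≤1) = ≼-trans
      (pointwise-≡ λ i → trans (cong (λ m → seq μ i ℚ.* fromℕ-ℚ m) (ℕ.m≤n⇒m∸n≡0 ∣S∣≤1)) (ℚ.*-zeroʳ (seq μ i)))
      (nonNeg⇒0≼ (W-nonNeg G isTree S))
    by-size zero    ∣S∣≤1   (no ∣S∣≰1) = contradiction ∣S∣≤1 ∣S∣≰1
    by-size (suc k) ∣S∣≤2+k (no ∣S∣≰1) =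
      let v , u , vu = someEdge G isTree conn (ℕ.≰⇒> ∣S∣≰1)
          s = edgeSplit G isTree conn vu
          open Split s
      in minWeight-split μ≼w s
        (minWeight-W μ≼w k (near G isTree conn v u) connᴬ 1≤∣A∣ (smaller 1≤∣B∣ ∣S∣≡∣A∣+∣B∣))
        (minWeight-W μ≼w k (far G isTree conn v u) connᴮ 1≤∣B∣
          (smaller 1≤∣A∣ (trans ∣S∣≡∣A∣+∣B∣ (ℕ.+-comm Subset.∣ near G isTree conn v u ∣ Subset.∣ far G isTree conn v u ∣))))
      where
      smaller : ∀ {p q} → 1 ≤ℕ q → Subset.∣ S ∣ ≡ p ℕ.+ q → p ≤ℕ suc k
      smaller {p} 1≤q ∣S∣≡p+q = ℕ.s≤s⁻¹ (ℕ.≤-trans (ℕ.m<m+n p 1≤q) (subst (_≤ℕ suc (suc k)) ∣S∣≡p+q ∣S∣≤2+k))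

  spread⇒light : ∀ Δ (2≤Δ : 2 ≤ℕ Δ) Λ → MaxDegree≤ G Δ → WeightSpread≤ G Λ → HasBalancedLightEdges G Δ 2≤Δ Λ
  spread⇒light Δ 2≤Δ Λ maxDegree (M , μ , M-max , μ-min , 0<μ , M÷μ≤Λ) S conn 2≤∣S∣ =
    let v , u , vu , bal = balancedEdge G isTree conn Δ 2≤Δ maxDegree 2≤∣S∣ in record
    { x        = v
    ; y        = u
    ; xy∈G[S]  = vu
    ; A        = near G isTree conn v u
    ; B        = far G isTree conn v u
    ; A-comp   = component-isComponent (removeEdge (induced E S) v u) v
    ; B-comp   = component-isComponent (removeEdge (induced E S) v u) u
    ; balanced = ≤[1-1/Δ]* Δ 2≤Δ
        {(Subset.∣ near G isTree conn v u ∣ ℕ.∸ 1) ℕ.⊔ (Subset.∣ far G isTree conn v u ∣ ℕ.∸ 1)} {m} bal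
    ; light    = ≼⁻ (light {v} {u} (proj₁ (induced⁻ E S vu)))
    }
    where
    open ≼-Reasoning
    m : ℕ
    m = Subset.∣ S ∣ ℕ.∸ 1
    instance
      m≢0 : ℕ.NonZero m
      m≢0 = pred-nonZero 2≤∣S∣

    w≼M : ∀ {x y} → T (E x y) → w x y ≼ M
    w≼M xy = ≼⁺ (IsMinimum.isLower M-max (_ , _ , xy))

    0<M : 0ℝ < M
    0<M = let (x , y , xy) , _ = IsMinimum.attained M-max in pos-upwards {w x y} {M} (w-pos xy) (w≼M xy)

    M≼Λμ : M ≼ Λ * μ
    M≼Λμ = ÷≼⇒≼* {M} {Λ} {μ} (pos⇒nonNeg {M} 0<M) 0<μ (≼⁺ M÷μ≤Λ)

    0≤Λ : EventuallyNonNeg Λ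
    0≤Λ = nonNeg-*-cancelʳ {Λ} {μ} (pos⇒nonNeg {μ} 0<μ) (pos-upwards {M} {Λ * μ} 0<M M≼Λμ)

    μ≼average : μ ≼ W G S ÷ℕ m
    μ≼average = begin
      μ                                        ∼⟨ pointwise-≡ (λ i → sym (trans (ℚ.*-assoc (seq μ i) (fromℕ-ℚ m) (+ 1 ℚ./ m))
                                                    (trans (cong (seq μ i ℚ.*_) (*-/-cancel 1 m)) (ℚ.*-identityʳ (seq μ i))))) ⟩
      μ * fromℕ m * fromℚ (+ 1 ℚ./ m)
        ∼⟨ *-monoˡ-≼ (fromℚ (+ 1 ℚ./ m)) (fromℚ-nonNeg (ℚ.nonNegative⁻¹ (+ 1 ℚ./ m) {{ℚ.normalize-nonNeg 1 m}}))
                                                    (minWeight-W (λ xy → ≼⁺ (IsMinimum.isLower μ-min (_ , _ , xy))) n S conn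
                                                      (ℕ.<⇒≤ 2≤∣S∣) (ℕ.m≤n⇒m≤1+n (Subset.∣p∣≤n S))) ⟩
      W G S ÷ℕ m                               ∎

    light : ∀ {x y} → T (E x y) → w x y ≼ Λ * (W G S ÷ℕ m)
    light {x} {y} xy = begin
      w x y                     ∼⟨ w≼M xy ⟩
      M                         ∼⟨ M≼Λμ ⟩
      Λ * μ                     ∼⟨ *-monoʳ-≼ Λ 0≤Λ μ≼average ⟩
      Λ * (W G S ÷ℕ m)          ∎

corollary12 : ∀ (Δ : ℕ) (2≤Δ : 2 ≤ℕ Δ) (Λ : ℝ) {n : ℕ} (2≤n : 2 ≤ℕ n) (G : WeightedGraph n) →
    IsTree G → MaxDegree≤ G Δ →
    (HasBalancedLightEdges G Δ 2≤Δ Λ → RatioBound G Δ 2≤Δ Λ) ×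
    (WeightSpread≤ G Λ → RatioBound G Δ 2≤Δ Λ)
corollary12 Δ 2≤Δ Λ 2≤n G isTree maxDegree =
  ratioBound G isTree Δ 2≤Δ Λ 2≤n ,
  ratioBound G isTree Δ 2≤Δ Λ 2≤n ∘ spread⇒light G isTree Δ 2≤Δ Λ maxDegree
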